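{- Let $n\ge 6$ be even and let $C$ be the outer cycle of the Wagner graph $V_n$. Then $\sum_{e\in E(C)}x_e\le 4$ defines a facet of $\textsc{Bond}(V_n)$.
   Context: For even $n$, the (generalized) Wagner graph $V_n$ is obtained from the cycle $C_n$ on vertices $1,\dots,n$ (in cyclic order) by adding the edges $\{i,i+\tfrac n2\}$ for $1\le i\le \tfrac n2$; this $C_n$ is its outer cycle. For a graph $G=(V,E)$ and $S\subseteq V$, the cut $\delta(S)=\{e\in E:|e\cap S|=1\}$ is a bond if $G[S]$ and $G[V\setminus S]$ are connected. $x^\delta$ is the incidence vector, $\textsc{Bond}(G)=\mathrm{conv}\{x^\delta:\delta\text{ a bond}\}$.
   Formalization: The polytope Bond(V_n) is taken over the rationals: its points, the convex coefficients and the affine independence that defines dimension use rational rather than real numbers; bonds are required to have both sides non-empty. -}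

module Defs where

open import Data.Nat as ℕ using (ℕ; zero; suc)
open import Data.Nat.DivMod using (_mod_)
open import Data.Fin using (Fin; toℕ; _↑ˡ_)
open import Data.Bool using (Bool; true; false; not; _xor_; if_then_else_)
open import Data.Sum using (_⊎_; inj₁; inj₂)
open import Data.Product using (Σ; ∃; _×_; _,_)
open import Data.Integer using (+_)
open import Data.Rational as ℚ using (ℚ; 0ℚ; 1ℚ; _/_)
open import Relation.Binary.PropositionalEquality using (_≡_)
open import Relation.Nullary using (¬_)

∑ : (k : ℕ) → (Fin k → ℚ) → ℚ
∑ zero    f = 0ℚ
∑ (suc k) f = f Fin.zero ℚ.+ ∑ k (λ i → f (Fin.suc i))

addMod : {n : ℕ} → ℕ → Fin n → Fin n
addMod {suc k} a i = (toℕ i ℕ.+ a) mod (suc k)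

-- The Wagner graph V_n for n = m + m.  Vertices: Fin n (0-based,
-- i.e. vertex i here is vertex i+1 of the paper).
-- Edges: inj₁ i = {i, i+1 mod n}  (outer cycle C_n),
--        inj₂ j = {j, j+m}        (chords), j < m.

Vert : ℕ → Set
Vert m = Fin (m ℕ.+ m)

Edge : ℕ → Set
Edge m = Fin (m ℕ.+ m) ⊎ Fin m

ends : (m : ℕ) → Edge m → Vert m × Vert m
ends m (inj₁ i) = i , addMod 1 i
ends m (inj₂ j) = (j ↑ˡ m) , addMod m (j ↑ˡ m)

Adj : (m : ℕ) → Vert m → Vert m → Set
Adj m u v = Σ (Edge m) (λ e → (ends m e ≡ (u , v)) ⊎ (ends m e ≡ (v , u)))

VSet : ℕ → Set
VSet m = Vert m → Bool

data Walk (m : ℕ) (S : VSet m) : Vert m → Vert m → Set where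
  here : ∀ {u} → Walk m S u u
  step : ∀ {u w v} → Adj m u w → S w ≡ true → Walk m S w v → Walk m S u v

-- G[S] is connected (and nonempty is imposed separately)
InducedConnected : (m : ℕ) → VSet m → Set
InducedConnected m S = ∀ u v → S u ≡ true → S v ≡ true → Walk m S u v

NonEmpty : (m : ℕ) → VSet m → Set
NonEmpty m S = Σ (Vert m) (λ v → S v ≡ true)

IsBond : (m : ℕ) → VSet m → Set
IsBond m S = NonEmpty m S × NonEmpty m (λ v → not (S v))
           × InducedConnected m S × InducedConnected m (λ v → not (S v))

Point : ℕ → Set
Point m = Edge m → ℚ

cutVec : (m : ℕ) → VSet m → Point m
cutVec m S e with ends m e
... | u , v = if S u xor S v then 1ℚ else 0ℚ

InBond : (m : ℕ) → Point m → Set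
InBond m x =
  Σ ℕ λ k → Σ (Fin k → VSet m) λ S → Σ (Fin k → ℚ) λ λs →
    (∀ i → IsBond m (S i)) × (∀ i → 0ℚ ℚ.≤ λs i) × (∑ k λs ≡ 1ℚ) ×
    (∀ e → x e ≡ ∑ k (λ i → λs i ℚ.* cutVec m (S i) e))

cycleSum : (m : ℕ) → Point m → ℚ
cycleSum m x = ∑ (m ℕ.+ m) (λ i → x (inj₁ i))

AffIndep : (m k : ℕ) → (Fin k → Point m) → Set
AffIndep m k p = ∀ (c : Fin k → ℚ) → ∑ k c ≡ 0ℚ →
  (∀ e → ∑ k (λ i → c i ℚ.* p i e) ≡ 0ℚ) → ∀ i → c i ≡ 0ℚ

HasAffIndep : (m : ℕ) → (Point m → Set) → ℕ → Set
HasAffIndep m P k = Σ (Fin k → Point m) λ p → (∀ i → P (p i)) × AffIndep m k p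

HasDim : (m : ℕ) → (Point m → Set) → ℕ → Set
HasDim m P d = HasAffIndep m P (suc d) × ¬ HasAffIndep m P (suc (suc d))

four : ℚ
four = + 4 / 1

IsFacetCycle : (m : ℕ) → (Point m → Set) → Set
IsFacetCycle m P =
  (∀ x → P x → cycleSum m x ℚ.≤ four) ×
  Σ ℕ λ d → HasDim m (λ x → P x × (cycleSum m x ≡ four)) d × HasDim m P (suc d)

{-# OPTIONS --safe #-}

-- Validity: let a bond with sides S and T cut B edges of the outer cycle.  The
-- functions f on the vertices that are constant along all uncut edges and vanish
-- at one vertex of S and one of T are zero, since both sides are connected.  The
-- equation of an uncut chord {t+1, t+1+m} is redundant unless a cycle edge of the
-- square between it and {t, t+m} is cut; let r be the number of remaining chord
-- equations.  Then n ≤ (n - B) + r + 2.  On the other hand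
-- 2 [chord t+1 is needed] ≤ (cut cycle edges of square t) + μ(t+1) - μ(t), where
-- μ(t) indicates that the chord {t, t+m} is uncut, and summing over t < m gives
-- 2r ≤ B.  Hence B ≤ 4.
--
-- Dimension: the sets {i, i+m}, {i, i+1, i+m, i+m+1} and {i, i+1, i+m} induce
-- bonds with exactly four cycle edges.  Let z and w be weights on the cycle edges
-- and chords that annihilate them all, and P(t) = z(t) + z(t+m).  The first two
-- kinds make P constant with P(i) + P(i+m-1) = 0, so P = 0; the third then gives
-- z(i+1) - z(i) + w(i+1) = 0, and comparing i with i + m yields w = 0 and z = 0.
-- So these cuts span, and 3m of them form a basis; the star of a single vertex,
-- which meets the cycle in two edges, completes it to an affine basis.

module Submission where

open import Defs
open import Data.Bool using (Bool; true; false; not; _xor_; _∧_; _∨_; if_then_else_)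
open import Data.Bool.Properties as Boolₚ using (xor-comm; ∨-comm)
open import Data.Fin using (Fin; zero; suc; toℕ; _↑ˡ_; _↑ʳ_; splitAt; join; remQuot; combine)
open import Data.Fin.Properties using (any?; toℕ-injective; toℕ-fromℕ<; toℕ<n; toℕ-↑ˡ; toℕ-↑ʳ; splitAt-↑ˡ; splitAt-↑ʳ; join-splitAt; splitAt-join; remQuot-combine)
open import Data.Nat as ℕ using (ℕ; zero; suc; s≤s; z≤n)
open import Data.Nat.DivMod using (_mod_; _%_; _/_; m%n<n; m<n⇒m%n≡m; %-distribˡ-+; m%n%n≡m%n; [m+n]%n≡m%n; [m+kn]%n≡m%n; m≡m%n+[m/n]*n)
import Data.Nat.Properties as ℕₚ
open import Data.Product using (Σ; ∃; _×_; _,_; proj₁; proj₂)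
open import Data.Rational using (ℚ; 0ℚ; 1ℚ; ½; _+_; _*_; -_; _-_; _≤_; _<_; _≟_; _≤?_; 1/_; ≢-nonZero; nonNegative)
open import Data.Rational.Properties
open import Data.Rational.Solver using (module +-*-Solver)
open import Data.Sum using (_⊎_; inj₁; inj₂; map₂; swap)
open import Function using (_∘_)
open import Relation.Binary.PropositionalEquality
open import Relation.Nullary using (¬_; yes; no; ¬?; contradiction)
open import Relation.Nullary.Decidable using (True; toWitness; decidable-stable)
open +-*-Solver

-- Finite sums

∑-cong : ∀ k {f g : Fin k → ℚ} → (∀ i → f i ≡ g i) → ∑ k f ≡ ∑ k g
∑-cong zero    h = refl
∑-cong (suc k) h = cong₂ _+_ (h zero) (∑-cong k (h ∘ suc))

∑-zero : ∀ k {f : Fin k → ℚ} → (∀ i → f i ≡ 0ℚ) → ∑ k f ≡ 0ℚ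
∑-zero zero    h = refl
∑-zero (suc k) h = cong₂ _+_ (h zero) (∑-zero k (h ∘ suc))

∑-+ : ∀ k (f g : Fin k → ℚ) → ∑ k (λ i → f i + g i) ≡ ∑ k f + ∑ k g
∑-+ zero    f g = refl
∑-+ (suc k) f g = trans (cong (f zero + g zero +_) (∑-+ k (f ∘ suc) (g ∘ suc)))
  (solve 4 (λ a b c d → a :+ b :+ (c :+ d) := a :+ c :+ (b :+ d)) refl (f zero) (g zero) (∑ k (f ∘ suc)) (∑ k (g ∘ suc)))

∑-* : ∀ k a (f : Fin k → ℚ) → ∑ k (λ i → a * f i) ≡ a * ∑ k f
∑-* zero    a f = sym (*-zeroʳ a)
∑-* (suc k) a f = trans (cong (a * f zero +_) (∑-* k a (f ∘ suc))) (sym (*-distribˡ-+ a (f zero) (∑ k (f ∘ suc))))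

∑-- : ∀ k (f g : Fin k → ℚ) → ∑ k (λ i → f i - g i) ≡ ∑ k f - ∑ k g
∑-- zero    f g = refl
∑-- (suc k) f g = trans (cong (f zero - g zero +_) (∑-- k (f ∘ suc) (g ∘ suc)))
  (solve 4 (λ a b c d → a :- b :+ (c :- d) := a :+ c :- (b :+ d)) refl (f zero) (g zero) (∑ k (f ∘ suc)) (∑ k (g ∘ suc)))

∑-mono : ∀ k {f g : Fin k → ℚ} → (∀ i → f i ≤ g i) → ∑ k f ≤ ∑ k g
∑-mono zero    h = ≤-refl
∑-mono (suc k) h = +-mono-≤ (h zero) (∑-mono k (h ∘ suc))

∑-swap : ∀ k l (f : Fin k → Fin l → ℚ) → ∑ k (λ i → ∑ l (f i)) ≡ ∑ l (λ j → ∑ k (λ i → f i j))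
∑-swap zero    l f = sym (∑-zero l λ _ → refl)
∑-swap (suc k) l f = trans (cong (∑ l (f zero) +_) (∑-swap k l (f ∘ suc)))
  (sym (∑-+ l (f zero) (λ j → ∑ k (λ i → f (suc i) j))))

∑-++ : ∀ k l (f : Fin (k ℕ.+ l) → ℚ) → ∑ (k ℕ.+ l) f ≡ ∑ k (λ i → f (i ↑ˡ l)) + ∑ l (λ j → f (k ↑ʳ j))
∑-++ zero    l f = sym (+-identityˡ _)
∑-++ (suc k) l f = trans (cong (f zero +_) (∑-++ k l (f ∘ suc))) (sym (+-assoc (f zero) _ _))

∑-last : ∀ k (f : ℕ → ℚ) → ∑ (suc k) (f ∘ toℕ) ≡ ∑ k (f ∘ toℕ) + f k
∑-last zero    f = trans (+-identityʳ (f 0)) (sym (+-identityˡ (f 0)))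
∑-last (suc k) f = trans (cong (f 0 +_) (∑-last k (f ∘ suc))) (sym (+-assoc (f 0) _ _))

∑-telescope : ∀ k (f : ℕ → ℚ) → ∑ k (λ i → f (suc (toℕ i)) - f (toℕ i)) ≡ f k - f 0
∑-telescope zero    f = sym (+-inverseʳ (f 0))
∑-telescope (suc k) f = trans (cong (f 1 - f 0 +_) (∑-telescope k (f ∘ suc)))
  (solve 3 (λ a b c → a :- b :+ (c :- a) := c :- b) refl (f 1) (f 0) (f (suc k)))

-- By induction on the shift: with `f s` added, both sums run over the k + 1 consecutive terms from
-- s on, whose first and last terms agree by periodicity.
∑-rotate : ∀ k (f : ℕ → ℚ) → (∀ t → f (t ℕ.+ k) ≡ f t) → ∀ s → ∑ k (λ i → f (toℕ i ℕ.+ s)) ≡ ∑ k (f ∘ toℕ)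
∑-rotate k f per zero    = ∑-cong k λ i → cong f (ℕₚ.+-identityʳ (toℕ i))
∑-rotate k f per (suc s) = trans (+-cancelʳ (f s) _ _ shift) (∑-rotate k f per s)
  where
  open ≡-Reasoning
  +-cancelʳ : ∀ a x y → x + a ≡ y + a → x ≡ y
  +-cancelʳ a x y e = begin
    x          ≡⟨ solve 2 (λ x a → x := x :+ a :- a) refl x a ⟩
    x + a - a  ≡⟨ cong (_- a) e ⟩
    y + a - a  ≡⟨ solve 2 (λ x a → x :+ a :- a := x) refl y a ⟩
    y          ∎
  g : ℕ → ℚ
  g t = f (t ℕ.+ s)
  shift : ∑ k (λ i → f (toℕ i ℕ.+ suc s)) + f s ≡ ∑ k (g ∘ toℕ) + f s
  shift = begin
    ∑ k (λ i → f (toℕ i ℕ.+ suc s)) + f s  ≡⟨ +-comm _ (f s) ⟩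
    f s + ∑ k (λ i → f (toℕ i ℕ.+ suc s))  ≡⟨ cong (f s +_) (∑-cong k λ i → cong f (ℕₚ.+-suc (toℕ i) s)) ⟩
    ∑ (suc k) (g ∘ toℕ)                    ≡⟨ ∑-last k g ⟩
    ∑ k (g ∘ toℕ) + g k                    ≡⟨ cong (∑ k (g ∘ toℕ) +_) (trans (cong f (ℕₚ.+-comm k s)) (per s)) ⟩
    ∑ k (g ∘ toℕ) + f s                    ∎

δ : ∀ {k} → Fin k → Fin k → ℚ
δ zero    zero    = 1ℚ
δ zero    (suc _) = 0ℚ
δ (suc _) zero    = 0ℚ
δ (suc i) (suc j) = δ i j

∑-δ : ∀ k (f : Fin k → ℚ) j → ∑ k (λ i → f i * δ i j) ≡ f j
∑-δ (suc k) f zero = trans (cong₂ _+_ (*-identityʳ (f zero)) (∑-zero k λ i → *-zeroʳ (f (suc i)))) (+-identityʳ (f zero))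
∑-δ (suc k) f (suc j) = trans (cong₂ _+_ (*-zeroʳ (f zero)) (∑-δ k (f ∘ suc) j)) (+-identityˡ (f (suc j)))

-- Gaussian elimination

Independent : ∀ {M N} → (Fin M → Fin N → ℚ) → Set
Independent {M} p = ∀ (c : Fin M → ℚ) → (∀ e → ∑ M (λ i → c i * p i e) ≡ 0ℚ) → ∀ i → c i ≡ 0ℚ

-- Spanning in dual form: no nonzero linear functional annihilates the family. Read with `p` as a
-- coefficient matrix, the homogeneous system with rows `p i` has only the trivial solution.
Spanning : ∀ {M N} → (Fin M → Fin N → ℚ) → Set
Spanning {N = N} p = ∀ (a : Fin N → ℚ) → (∀ i → ∑ N (λ e → a e * p i e) ≡ 0ℚ) → ∀ e → a e ≡ 0ℚ

inverse : ∀ x → x ≢ 0ℚ → Σ ℚ λ y → y * x ≡ 1ℚ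
inverse x x≢0 = (1/ x) {{≢-nonZero x≢0}} , *-inverseˡ x {{≢-nonZero x≢0}}

-- Otherwise the functional that reads off the first coordinate would annihilate the whole family
-- without being zero.
pivot : ∀ {M N} (p : Fin M → Fin (suc N) → ℚ) → Spanning p → ∃ λ i → p i zero ≢ 0ℚ
pivot {M} {N} p span with any? (λ i → ¬? (p i zero ≟ 0ℚ))
... | yes q = q
... | no ¬q = contradiction (span (λ e → δ e zero) orth zero) 1≢0
  where
  orth : ∀ i → ∑ (suc N) (λ e → δ e zero * p i e) ≡ 0ℚ
  orth i = begin
    ∑ (suc N) (λ e → δ e zero * p i e)  ≡⟨ ∑-cong (suc N) (λ e → *-comm (δ e zero) (p i e)) ⟩
    ∑ (suc N) (λ e → p i e * δ e zero)  ≡⟨ ∑-δ (suc N) (p i) zero ⟩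
    p i zero                            ≡⟨ decidable-stable (p i zero ≟ 0ℚ) (λ n → ¬q (i , n)) ⟩
    0ℚ                                  ∎
    where open ≡-Reasoning

-- One elimination step: column `zero` is cleared with row `i₀` and then dropped. All row indices
-- are kept, so row `i₀` stays in the list as a zero row.
module Eliminate {M N} (p : Fin M → Fin (suc N) → ℚ) (i₀ : Fin M) (ι : ℚ) (ι* : ι * p i₀ zero ≡ 1ℚ) where
  open ≡-Reasoning

  ratio : Fin M → ℚ
  ratio j = p j zero * ι

  reduced : Fin M → Fin N → ℚ
  reduced j e = p j (suc e) - ratio j * p i₀ (suc e)

  spanning : Spanning p → Spanning reduced
  spanning span a orth e = span a⁺ orth⁺ (suc e)
    where
    s : Fin M → ℚ
    s j = ∑ N (λ e → a e * p j (suc e))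
    a⁺ : Fin (suc N) → ℚ
    -- This value makes the extended functional vanish on row `i₀`; on any row j it then takes the
    -- value of `a` on the reduced row.
    a⁺ zero    = - (ι * s i₀)
    a⁺ (suc e) = a e
    rel : ∀ j → s j - ratio j * s i₀ ≡ 0ℚ
    rel j = begin
      s j - ratio j * s i₀
        ≡⟨ cong (λ x → s j - x) (sym (∑-* N (ratio j) _)) ⟩
      s j - ∑ N (λ e → ratio j * (a e * p i₀ (suc e)))
        ≡⟨ sym (∑-- N _ _) ⟩
      ∑ N (λ e → a e * p j (suc e) - ratio j * (a e * p i₀ (suc e)))
        ≡⟨ ∑-cong N (λ e → solve 4 (λ a x r y → a :* x :- r :* (a :* y) := a :* (x :- r :* y)) refl (a e) (p j (suc e)) (ratio j) (p i₀ (suc e))) ⟩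
      ∑ N (λ e → a e * reduced j e)
        ≡⟨ orth j ⟩
      0ℚ ∎
    orth⁺ : ∀ j → - (ι * s i₀) * p j zero + s j ≡ 0ℚ
    orth⁺ j = trans (solve 4 (λ ι s x t → :- (ι :* s) :* x :+ t := t :- x :* ι :* s) refl ι (s i₀) (p j zero) (s j)) (rel j)

  -- Column `zero` of a relation expresses the coefficient of the pivot row through the others.
  -- Substituting it turns the remaining columns into a relation among the reduced rows.
  independent : ∀ {K} (σ : Fin K → Fin M) → Independent (reduced ∘ σ) →
                Σ (Fin (suc K) → Fin M) λ σ⁺ → Independent (p ∘ σ⁺)
  independent {K} σ ind = σ⁺ , ind⁺
    where
    σ⁺ : Fin (suc K) → Fin M
    σ⁺ zero    = i₀
    σ⁺ (suc k) = σ k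
    ind⁺ : Independent (p ∘ σ⁺)
    ind⁺ c eqs = λ { zero → trans c₀≡ (cong -_ ρ≡0) ; (suc k) → c≡0 k }
      where
      c′ : Fin K → ℚ
      c′ = c ∘ suc
      ρ : ℚ
      ρ = ∑ K (λ k → c′ k * ratio (σ k))
      h : Fin (suc N) → ℚ
      h e = ∑ K (λ k → c′ k * p (σ k) e)
      ρ≡ : ρ ≡ ι * h zero
      ρ≡ = trans (∑-cong K λ k → solve 3 (λ c x i → c :* (x :* i) := i :* (c :* x)) refl (c′ k) (p (σ k) zero) ι) (∑-* K ι _)
      c₀≡ : c zero ≡ - ρ
      c₀≡ = begin
        c zero
          ≡⟨ solve 4 (λ c i x h → c := i :* (c :* x :+ h) :+ c :* (con 1ℚ :- i :* x) :- i :* h) refl (c zero) ι (p i₀ zero) (h zero) ⟩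
        ι * (c zero * p i₀ zero + h zero) + c zero * (1ℚ - ι * p i₀ zero) - ι * h zero
          ≡⟨ cong₂ (λ x y → ι * x + c zero * (1ℚ - y) - ι * h zero) (eqs zero) ι* ⟩
        ι * 0ℚ + c zero * (1ℚ - 1ℚ) - ι * h zero
          ≡⟨ solve 3 (λ i c x → i :* con 0ℚ :+ c :* (con 1ℚ :- con 1ℚ) :- x := :- x) refl ι (c zero) (ι * h zero) ⟩
        - (ι * h zero)
          ≡⟨ cong -_ (sym ρ≡) ⟩
        - ρ ∎
      tail : ∀ e → ∑ K (λ k → c′ k * reduced (σ k) e) ≡ 0ℚ
      tail e = begin
        ∑ K (λ k → c′ k * reduced (σ k) e)
          ≡⟨ ∑-cong K (λ k → solve 4 (λ c x r y → c :* (x :- r :* y) := c :* x :- y :* (c :* r)) refl (c′ k) (p (σ k) (suc e)) (ratio (σ k)) (p i₀ (suc e))) ⟩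
        ∑ K (λ k → c′ k * p (σ k) (suc e) - p i₀ (suc e) * (c′ k * ratio (σ k)))
          ≡⟨ ∑-- K _ _ ⟩
        h (suc e) - ∑ K (λ k → p i₀ (suc e) * (c′ k * ratio (σ k)))
          ≡⟨ cong (λ x → h (suc e) - x) (∑-* K (p i₀ (suc e)) _) ⟩
        h (suc e) - p i₀ (suc e) * ρ
          ≡⟨ solve 3 (λ h x r → h :- x :* r := :- r :* x :+ h) refl (h (suc e)) (p i₀ (suc e)) ρ ⟩
        - ρ * p i₀ (suc e) + h (suc e)
          ≡⟨ cong (λ c → c * p i₀ (suc e) + h (suc e)) (sym c₀≡) ⟩
        c zero * p i₀ (suc e) + h (suc e)
          ≡⟨ eqs (suc e) ⟩
        0ℚ ∎
      c≡0 : ∀ k → c′ k ≡ 0ℚ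
      c≡0 = ind c′ tail
      ρ≡0 : ρ ≡ 0ℚ
      ρ≡0 = ∑-zero K λ k → trans (cong (_* ratio (σ k)) (c≡0 k)) (*-zeroˡ (ratio (σ k)))

  reduced-pivot : ∀ e → reduced i₀ e ≡ 0ℚ
  reduced-pivot e = begin
    p i₀ (suc e) - p i₀ zero * ι * p i₀ (suc e)  ≡⟨ cong (λ r → p i₀ (suc e) - r * p i₀ (suc e)) (trans (*-comm (p i₀ zero) ι) ι*) ⟩
    p i₀ (suc e) - 1ℚ * p i₀ (suc e)             ≡⟨ solve 1 (λ x → x :- con 1ℚ :* x := con 0ℚ) refl (p i₀ (suc e)) ⟩
    0ℚ                                           ∎

  reduced-zero : ∀ j → (∀ e → p j e ≡ 0ℚ) → ∀ e → reduced j e ≡ 0ℚ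
  reduced-zero j p≡0 e = begin
    p j (suc e) - p j zero * ι * p i₀ (suc e)  ≡⟨ cong₂ (λ x y → x - y * ι * p i₀ (suc e)) (p≡0 (suc e)) (p≡0 zero) ⟩
    0ℚ - 0ℚ * ι * p i₀ (suc e)                 ≡⟨ solve 2 (λ i x → con 0ℚ :- con 0ℚ :* i :* x := con 0ℚ) refl ι (p i₀ (suc e)) ⟩
    0ℚ                                         ∎

-- Each of the N columns contributes one pivot row to the selection.
spanning⇒basis : ∀ {M} N (p : Fin M → Fin N → ℚ) → Spanning p → Σ (Fin N → Fin M) λ σ → Independent (p ∘ σ)
spanning⇒basis zero    p span = (λ ()) , λ _ _ ()
spanning⇒basis (suc N) p span = independent (proj₁ rec) (proj₂ rec)
  where
  i = pivot p span
  ι = inverse (p (proj₁ i) zero) (proj₂ i)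
  open Eliminate p (proj₁ i) (proj₁ ι) (proj₂ ι)
  rec = spanning⇒basis N reduced (spanning span)

-- The weights w dominate the indicator of the nonzero members of p.
Covers : ∀ {M N} → (Fin M → Fin N → ℚ) → (Fin M → ℚ) → Set
Covers p w = ∀ i → 0ℚ ≤ w i × ((∀ e → p i e ≡ 0ℚ) ⊎ 1ℚ ≤ w i)

-- A system with only the trivial solution has at least as many nonzero rows as unknowns. Each
-- column uses up a pivot row, which is nonzero and so has weight at least 1.
spanning⇒weight : ∀ {M} N (p : Fin M → Fin N → ℚ) → Spanning p → ∀ w → Covers p w → ∑ N (λ _ → 1ℚ) ≤ ∑ M w
spanning⇒weight {M} zero    p span w cov =
  ≤-trans (≤-reflexive (sym (∑-zero M {λ _ → 0ℚ} λ _ → refl))) (∑-mono M λ i → proj₁ (cov i))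
spanning⇒weight {M} (suc N) p span w cov = begin
    1ℚ + ∑ N (λ _ → 1ℚ)            ≤⟨ +-mono-≤ 1≤wᵢ (spanning⇒weight N reduced (spanning span) w′ cov′) ⟩
    w i + ∑ M w′                   ≡⟨ cong (w i +_) (∑-- M w (λ j → w j * δ j i)) ⟩
    w i + (∑ M w - ∑ M (λ j → w j * δ j i)) ≡⟨ cong (λ x → w i + (∑ M w - x)) (∑-δ M w i) ⟩
    w i + (∑ M w - w i)            ≡⟨ solve 2 (λ x y → x :+ (y :- x) := y) refl (w i) (∑ M w) ⟩
    ∑ M w                          ∎
  where
  open ≤-Reasoning
  i = proj₁ (pivot p span)
  pᵢ≢0 = proj₂ (pivot p span)
  ι = inverse (p i zero) pᵢ≢0
  open Eliminate p i (proj₁ ι) (proj₂ ι)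
  -- The pivot row is zero after the reduction, so its weight can be lowered to 0; all other weights
  -- stay.
  w′ : Fin M → ℚ
  w′ j = w j - w j * δ j i
  1≤wᵢ : 1ℚ ≤ w i
  1≤wᵢ with cov i
  ... | _ , inj₁ p≡0 = contradiction (p≡0 zero) pᵢ≢0
  ... | _ , inj₂ 1≤  = 1≤
  δ-dec : ∀ {k} (a b : Fin k) → (a ≡ b × δ a b ≡ 1ℚ) ⊎ δ a b ≡ 0ℚ
  δ-dec zero    zero    = inj₁ (refl , refl)
  δ-dec zero    (suc b) = inj₂ refl
  δ-dec (suc a) zero    = inj₂ refl
  δ-dec (suc a) (suc b) with δ-dec a b
  ... | inj₁ (refl , e) = inj₁ (refl , e)
  ... | inj₂ e          = inj₂ e
  cov′ : Covers reduced w′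
  cov′ j with δ-dec j i
  ... | inj₁ (refl , δ≡1) = ≤-reflexive (sym (trans (cong (λ x → w j - w j * x) δ≡1)
          (solve 1 (λ x → x :- x :* con 1ℚ := con 0ℚ) refl (w j)))) , inj₁ reduced-pivot
  ... | inj₂ δ≡0 = subst (0ℚ ≤_) w≡w′ (proj₁ (cov j)) , big (proj₂ (cov j))
    where
    w≡w′ : w j ≡ w′ j
    w≡w′ = trans (solve 1 (λ x → x := x :- x :* con 0ℚ) refl (w j)) (cong (λ x → w j - w j * x) (sym δ≡0))
    big : (∀ e → p j e ≡ 0ℚ) ⊎ 1ℚ ≤ w j → (∀ e → reduced j e ≡ 0ℚ) ⊎ 1ℚ ≤ w′ j
    big (inj₁ p≡0) = inj₁ (reduced-zero j p≡0)
    big (inj₂ 1≤)  = inj₂ (subst (1ℚ ≤_) w≡w′ 1≤)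

-- The transpose of p spans exactly when p is independent.
¬independent : ∀ N (p : Fin (suc N) → Fin N → ℚ) → ¬ Independent p
¬independent N p ind = <-irrefl refl (begin-strict
    ∑ N (λ _ → 1ℚ)       <⟨ subst (_< 1ℚ + ∑ N (λ _ → 1ℚ)) (+-identityˡ (∑ N (λ _ → 1ℚ))) (+-monoˡ-< (∑ N (λ _ → 1ℚ)) (positive⁻¹ 1ℚ)) ⟩
    ∑ (suc N) (λ _ → 1ℚ) ≤⟨ spanning⇒weight (suc N) (λ e i → p i e) ind (λ _ → 1ℚ) (λ i → <⇒≤ (positive⁻¹ 1ℚ) , inj₂ ≤-refl) ⟩
    ∑ N (λ _ → 1ℚ)       ∎)
  where open ≤-Reasoning

-- Indicators, edge equations and periodic indices

≤-decide : ∀ {x y} {t : True (x ≤? y)} → x ≤ y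
≤-decide {t = t} = toWitness t

χ : Bool → ℚ
χ b = if b then 1ℚ else 0ℚ

∑-⊎ : ∀ k l (g : Fin k ⊎ Fin l → ℚ) → ∑ (k ℕ.+ l) (g ∘ splitAt k) ≡ ∑ k (g ∘ inj₁) + ∑ l (g ∘ inj₂)
∑-⊎ k l g = trans (∑-++ k l (g ∘ splitAt k))
  (cong₂ _+_ (∑-cong k λ i → cong g (splitAt-↑ˡ k i l)) (∑-cong l λ j → cong g (splitAt-↑ʳ k l j)))

∑-δ-diff : ∀ k (f : Fin k → ℚ) i j → ∑ k (λ v → f v * (δ v i - δ v j)) ≡ f i - f j
∑-δ-diff k f i j = begin
  ∑ k (λ v → f v * (δ v i - δ v j))
    ≡⟨ ∑-cong k (λ v → solve 3 (λ x y z → x :* (y :- z) := x :* y :- x :* z) refl (f v) (δ v i) (δ v j)) ⟩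
  ∑ k (λ v → f v * δ v i - f v * δ v j)
    ≡⟨ ∑-- k _ _ ⟩
  ∑ k (λ v → f v * δ v i) - ∑ k (λ v → f v * δ v j)
    ≡⟨ cong₂ _-_ (∑-δ k f i) (∑-δ k f j) ⟩
  f i - f j ∎
  where open ≡-Reasoning

x-y≡0⇒x≡y : ∀ x y → x - y ≡ 0ℚ → x ≡ y
x-y≡0⇒x≡y x y e = trans (solve 2 (λ x y → x := x :- y :+ y) refl x y) (trans (cong (_+ y) e) (+-identityˡ y))

-- Induction on the quotient in t = t % k + (t / k) * k. It carries facts about the edges, which are
-- indexed by `Fin`, over to positions in ℕ.
periodic : ∀ k .{{_ : ℕ.NonZero k}} (Q : ℕ → Set) → (∀ (j : Fin k) → Q (toℕ j)) → (∀ t → Q t → Q (t ℕ.+ k)) → ∀ t → Q t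
periodic k Q base shift t = subst Q (sym (m≡m%n+[m/n]*n t k)) (go (t / k))
  where
  go : ∀ q → Q (t % k ℕ.+ q ℕ.* k)
  go zero    = subst Q (trans (toℕ-fromℕ< (m%n<n t k)) (sym (ℕₚ.+-identityʳ (t % k)))) (base (t mod k))
  go (suc q) = subst Q (trans (ℕₚ.+-assoc (t % k) (q ℕ.* k) k) (cong (t % k ℕ.+_) (ℕₚ.+-comm (q ℕ.* k) k))) (shift _ (go q))

xor-false⇒≡ : ∀ a b → a xor b ≡ false → a ≡ b
xor-false⇒≡ true  true  _ = refl
xor-false⇒≡ false false _ = refl

≡⇒xor-false : ∀ {a b} → a ≡ b → a xor b ≡ false
≡⇒xor-false {true}  refl = refl
≡⇒xor-false {false} refl = refl

-- Positions on the outer cycle and cuts of the Wagner graph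

module Wagner (m′ : ℕ) where

  m n : ℕ
  m = suc m′
  n = m ℕ.+ m

  -- Positions are arbitrary natural numbers read modulo n, so that t + 1 and t + m never need a
  -- case for wrapping around.
  vert : ℕ → Vert m
  vert t = t mod n

  toℕ-vert : ∀ t → toℕ (vert t) ≡ t % n
  toℕ-vert t = toℕ-fromℕ< (m%n<n t n)

  vert-cong : ∀ s t → s % n ≡ t % n → vert s ≡ vert t
  vert-cong s t e = toℕ-injective (trans (toℕ-vert s) (trans e (sym (toℕ-vert t))))

  vert-toℕ : ∀ u → vert (toℕ u) ≡ u
  vert-toℕ u = toℕ-injective (trans (toℕ-vert (toℕ u)) (m<n⇒m%n≡m (toℕ<n u)))

  addMod-vert : ∀ a t → addMod a (vert t) ≡ vert (t ℕ.+ a)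
  addMod-vert a t = vert-cong (toℕ (vert t) ℕ.+ a) (t ℕ.+ a) (trans (cong (λ x → (x ℕ.+ a) % n) (toℕ-vert t)) (begin
    (t % n ℕ.+ a) % n              ≡⟨ %-distribˡ-+ (t % n) a n ⟩
    (t % n % n ℕ.+ a % n) % n      ≡⟨ cong (λ x → (x ℕ.+ a % n) % n) (m%n%n≡m%n t n) ⟩
    (t % n ℕ.+ a % n) % n          ≡⟨ sym (%-distribˡ-+ t a n) ⟩
    (t ℕ.+ a) % n                  ∎))
    where open ≡-Reasoning

  addMod1-vert : ∀ t → addMod 1 (vert t) ≡ vert (suc t)
  addMod1-vert t = trans (addMod-vert 1 t) (cong vert (ℕₚ.+-comm t 1))

  addMod-toℕ : ∀ a u → addMod a u ≡ vert (toℕ u ℕ.+ a)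
  addMod-toℕ a u = trans (cong (addMod a) (sym (vert-toℕ u))) (addMod-vert a (toℕ u))

  vert-+m+m : ∀ t → vert (t ℕ.+ m ℕ.+ m) ≡ vert t
  vert-+m+m t = vert-cong (t ℕ.+ m ℕ.+ m) t (trans (cong (_% n) (ℕₚ.+-assoc t m m)) ([m+n]%n≡m%n t n))

  vert-+n : ∀ t → vert (t ℕ.+ n) ≡ vert t
  vert-+n t = vert-cong (t ℕ.+ n) t ([m+n]%n≡m%n t n)

  ends-chord : ∀ j → ends m (inj₂ j) ≡ (vert (toℕ j) , vert (toℕ j ℕ.+ m))
  ends-chord j = cong₂ _,_ eq (trans (cong (addMod m) eq) (addMod-vert m (toℕ j)))
    where
    eq : j ↑ˡ m ≡ vert (toℕ j)
    eq = trans (sym (vert-toℕ (j ↑ˡ m))) (cong vert (toℕ-↑ˡ j m))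

  ∑-halves : ∀ (g : ℕ → ℚ) → ∑ n (g ∘ toℕ) ≡ ∑ m (λ j → g (toℕ j)) + ∑ m (λ j → g (toℕ j ℕ.+ m))
  ∑-halves g = trans (∑-++ m m (g ∘ toℕ)) (cong₂ _+_
    (∑-cong m λ j → cong g (toℕ-↑ˡ j m))
    (∑-cong m λ j → cong g (trans (toℕ-↑ʳ m j) (ℕₚ.+-comm m (toℕ j)))))

  module Cut (S : VSet m) where

    s : ℕ → Bool
    s t = S (vert t)

    s-+m+m : ∀ t → s (t ℕ.+ m ℕ.+ m) ≡ s t
    s-+m+m t = cong S (vert-+m+m t)

    cutᶜ : ℕ → Bool
    cutᶜ t = s t xor s (suc t)

    cutVec-cycle : ∀ u → cutVec m S (inj₁ u) ≡ χ (cutᶜ (toℕ u))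
    cutVec-cycle u = cong χ (cong₂ _xor_ (cong S (sym (vert-toℕ u)))
      (cong S (trans (addMod-toℕ 1 u) (cong vert (ℕₚ.+-comm (toℕ u) 1)))))

    cutVec-chord : ∀ j → cutVec m S (inj₂ j) ≡ χ (s (toℕ j) xor s (toℕ j ℕ.+ m))
    cutVec-chord j = cong (λ e → χ (S (proj₁ e) xor S (proj₂ e))) (ends-chord j)

    cycleSum-cut : cycleSum m (cutVec m S) ≡ ∑ m (λ j → χ (cutᶜ (toℕ j))) + ∑ m (λ j → χ (cutᶜ (toℕ j ℕ.+ m)))
    cycleSum-cut = trans (∑-cong n cutVec-cycle) (∑-halves (χ ∘ cutᶜ))

  -- A cut meets the square with chords ab, a′b′ and cycle edges aa′, bb′ in an even number of
  -- edges. If `inc` is 1, either both cycle edges are cut, or one of them and the chord ab, which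
  -- gives 1 + 1 on the right. If `inc` is 0, the difference of the last two terms is -1 only when
  -- a′b′ alone of the chords is cut, and then a cycle edge is cut too.
  square-ineq : ∀ a b a′ b′ → let inc = χ (not (a′ xor b′) ∧ ((a xor a′) ∨ (b xor b′))) in
    inc + inc ≤ (χ (a xor a′) + χ (b xor b′)) + (χ (not (a′ xor b′)) - χ (not (a xor b)))
  square-ineq true  true  true  true  = ≤-decide
  square-ineq true  true  true  false = ≤-decide
  square-ineq true  true  false true  = ≤-decide
  square-ineq true  true  false false = ≤-decide
  square-ineq true  false true  true  = ≤-decide
  square-ineq true  false true  false = ≤-decide
  square-ineq true  false false true  = ≤-decide
  square-ineq true  false false false = ≤-decide
  square-ineq false true  true  true  = ≤-decide
  square-ineq false true  true  false = ≤-decide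
  square-ineq false true  false true  = ≤-decide
  square-ineq false true  false false = ≤-decide
  square-ineq false false true  true  = ≤-decide
  square-ineq false false true  false = ≤-decide
  square-ineq false false false true  = ≤-decide
  square-ineq false false false false = ≤-decide

  -- Validity of the inequality

  module Bound (S : VSet m) (bond : IsBond m S) where
    open Cut S

    v₁ v₀ : Vert m
    v₁ = proj₁ (proj₁ bond)
    v₀ = proj₁ (proj₁ (proj₂ bond))

    mono square-cut needed : ℕ → Bool
    mono t = not (s t xor s (t ℕ.+ m))
    square-cut t = cutᶜ t ∨ cutᶜ (t ℕ.+ m)
    -- The equation of chord t + 1 follows from that of chord t when no cycle edge between them is cut.
    needed t = mono (suc t) ∧ square-cut t

    mono-+m : ∀ t → mono (t ℕ.+ m) ≡ mono t
    mono-+m t = cong not (trans (cong (s (t ℕ.+ m) xor_) (s-+m+m t)) (xor-comm (s (t ℕ.+ m)) (s t)))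

    needed-+m : ∀ t → needed (t ℕ.+ m) ≡ needed t
    needed-+m t = cong₂ _∧_ (mono-+m (suc t)) (trans
      (cong (cutᶜ (t ℕ.+ m) ∨_) (cong₂ _xor_ (s-+m+m t) (s-+m+m (suc t))))
      (∨-comm (cutᶜ (t ℕ.+ m)) (cutᶜ t)))

    Eqn : Set
    Eqn = Fin n ⊎ (Fin m ⊎ Fin 2)

    -- The linear system for f: equality along uncut cycle edges and needed chords, and f = 0 at
    -- `v₁` and `v₀`. Absent equations remain as zero rows, so that the index type does not depend
    -- on S.
    row : Eqn → Fin n → ℚ
    row (inj₁ u) v = if cutᶜ (toℕ u) then 0ℚ else δ v (vert (toℕ u)) - δ v (vert (suc (toℕ u)))
    -- The index j names a square, and the equation belongs to the chord at its far end, j + 1.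
    row (inj₂ (inj₁ j)) v = if needed (toℕ j) then δ v (vert (suc (toℕ j))) - δ v (vert (suc (toℕ j) ℕ.+ m)) else 0ℚ
    row (inj₂ (inj₂ zero)) v = δ v v₁
    row (inj₂ (inj₂ (suc _))) v = δ v v₀

    weight : Eqn → ℚ
    weight (inj₁ u) = 1ℚ - χ (cutᶜ (toℕ u))
    weight (inj₂ (inj₁ j)) = χ (needed (toℕ j))
    weight (inj₂ (inj₂ _)) = 1ℚ

    covers : ∀ e → 0ℚ ≤ weight e × ((∀ v → row e v ≡ 0ℚ) ⊎ 1ℚ ≤ weight e)
    covers (inj₁ u) with cutᶜ (toℕ u)
    ... | true  = ≤-decide , inj₁ λ _ → refl
    ... | false = ≤-decide , inj₂ ≤-decide
    covers (inj₂ (inj₁ j)) with needed (toℕ j)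
    ... | true  = ≤-decide , inj₂ ≤-decide
    ... | false = ≤-decide , inj₁ λ _ → refl
    covers (inj₂ (inj₂ _)) = ≤-decide , inj₂ ≤-decide

    -- The cut edge at `t₀` starts the induction along the chords: it lies in the square before
    -- chord t₀ + 1, so that chord, if uncut, has its own row.
    module Solution (t₀ : ℕ) (cut₀ : cutᶜ t₀ ≡ true) (f : Fin n → ℚ)
                    (orth : ∀ e → ∑ n (λ v → f v * row e v) ≡ 0ℚ) where

      φ : ℕ → ℚ
      φ t = f (vert t)

      φ-+m+m : ∀ t → φ (t ℕ.+ m ℕ.+ m) ≡ φ t
      φ-+m+m t = cong f (vert-+m+m t)

      φ-edge-Fin : ∀ (u : Fin n) → cutᶜ (toℕ u) ≡ false → φ (toℕ u) ≡ φ (suc (toℕ u))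
      φ-edge-Fin u uncut = x-y≡0⇒x≡y _ _ (begin
        φ (toℕ u) - φ (suc (toℕ u))
          ≡⟨ sym (∑-δ-diff n f _ _) ⟩
        ∑ n (λ v → f v * (δ v (vert (toℕ u)) - δ v (vert (suc (toℕ u)))))
          ≡⟨ cong (λ b → ∑ n (λ v → f v * (if b then 0ℚ else δ v (vert (toℕ u)) - δ v (vert (suc (toℕ u)))))) (sym uncut) ⟩
        ∑ n (λ v → f v * row (inj₁ u) v)
          ≡⟨ orth (inj₁ u) ⟩
        0ℚ ∎)
        where open ≡-Reasoning

      φ-edge : ∀ t → cutᶜ t ≡ false → φ t ≡ φ (suc t)
      φ-edge = periodic n (λ t → cutᶜ t ≡ false → φ t ≡ φ (suc t)) φ-edge-Fin
        λ t h uncut → trans (cong f (vert-+n t)) (trans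
          (h (trans (sym (cong₂ _xor_ (cong S (vert-+n t)) (cong S (vert-+n (suc t))))) uncut))
          (cong f (sym (vert-+n (suc t)))))

      φ-needed-Fin : ∀ (j : Fin m) → needed (toℕ j) ≡ true → φ (suc (toℕ j)) ≡ φ (suc (toℕ j) ℕ.+ m)
      φ-needed-Fin j need = x-y≡0⇒x≡y _ _ (begin
        φ (suc (toℕ j)) - φ (suc (toℕ j) ℕ.+ m)
          ≡⟨ sym (∑-δ-diff n f _ _) ⟩
        ∑ n (λ v → f v * (δ v (vert (suc (toℕ j))) - δ v (vert (suc (toℕ j) ℕ.+ m))))
          ≡⟨ cong (λ b → ∑ n (λ v → f v * (if b then δ v (vert (suc (toℕ j))) - δ v (vert (suc (toℕ j) ℕ.+ m)) else 0ℚ))) (sym need) ⟩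
        ∑ n (λ v → f v * row (inj₂ (inj₁ j)) v)
          ≡⟨ orth (inj₂ (inj₁ j)) ⟩
        0ℚ ∎)
        where open ≡-Reasoning

      -- Square t + m is square t with its two sides exchanged, so the shift by m reverses the
      -- equation.
      φ-needed : ∀ t → needed t ≡ true → φ (suc t) ≡ φ (suc t ℕ.+ m)
      φ-needed = periodic m (λ t → needed t ≡ true → φ (suc t) ≡ φ (suc t ℕ.+ m)) φ-needed-Fin
        λ t h need → trans (sym (h (trans (sym (needed-+m t)) need))) (sym (φ-+m+m (suc t)))

      Chord : ℕ → Set
      Chord t = mono t ≡ true → φ t ≡ φ (t ℕ.+ m)

      -- If a cycle edge of the square is cut, the equation is a row of the system. Otherwise both S
      -- and f are constant along the two cycle edges, and the equation is inherited from chord t.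
      chord-step : ∀ t → Chord t → Chord (suc t)
      chord-step t ih mono⁺ with cutᶜ t in c₁ | cutᶜ (t ℕ.+ m) in c₂
      ... | true  | _     = φ-needed t (cong₂ _∧_ mono⁺ (cong (_∨ cutᶜ (t ℕ.+ m)) c₁))
      ... | false | true  = φ-needed t (cong₂ _∧_ mono⁺ (cong₂ _∨_ c₁ c₂))
      ... | false | false = trans (sym (φ-edge t c₁)) (trans
        (ih (trans (cong not (cong₂ _xor_ (xor-false⇒≡ (s t) (s (suc t)) c₁) (xor-false⇒≡ (s (t ℕ.+ m)) (s (suc t ℕ.+ m)) c₂))) mono⁺))
        (φ-edge (t ℕ.+ m) c₂))

      chord-after : ∀ d → Chord (d ℕ.+ suc t₀)
      chord-after zero    mono⁺ = φ-needed t₀ (cong₂ _∧_ mono⁺ (cong (_∨ cutᶜ (t₀ ℕ.+ m)) cut₀))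
      chord-after (suc d) = chord-step (d ℕ.+ suc t₀) (chord-after d)

      -- Chords t and t + m are the same edge with ends exchanged, so the equation descends by
      -- multiples of m.
      chord-before : ∀ q t → Chord (q ℕ.* m ℕ.+ t) → Chord t
      chord-before zero    t h = h
      chord-before (suc q) t h = chord-before q t λ mono⁺ → let r = q ℕ.* m ℕ.+ t in
        trans (sym (φ-+m+m r)) (sym (subst Chord (trans (ℕₚ.+-assoc m (q ℕ.* m) t) (ℕₚ.+-comm m r)) h (trans (mono-+m r) mono⁺)))

      chord : ∀ t → Chord t
      -- Since m is at least 1, the position (t₀ + 1) m + t is at least t₀ + 1, hence within reach
      -- of `chord-after`.
      chord t = chord-before (suc t₀) t (subst Chord (begin
        m′ ℕ.* suc t₀ ℕ.+ t ℕ.+ suc t₀    ≡⟨ ℕₚ.+-comm _ (suc t₀) ⟩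
        suc t₀ ℕ.+ (m′ ℕ.* suc t₀ ℕ.+ t)  ≡⟨ sym (ℕₚ.+-assoc (suc t₀) _ t) ⟩
        m ℕ.* suc t₀ ℕ.+ t                ≡⟨ cong (ℕ._+ t) (ℕₚ.*-comm m (suc t₀)) ⟩
        suc t₀ ℕ.* m ℕ.+ t                ∎) (chord-after (m′ ℕ.* suc t₀ ℕ.+ t)))
        where open ≡-Reasoning

      f-edge : ∀ e {u v} → ends m e ≡ (u , v) → S u ≡ S v → f u ≡ f v
      f-edge (inj₁ u) refl Su≡Sv = trans (cong f (sym (vert-toℕ u))) (trans
        (φ-edge (toℕ u) (trans (cong₂ _xor_ (cong S (vert-toℕ u)) (cong S (sym next))) (≡⇒xor-false Su≡Sv)))
        (cong f (sym next)))
        where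
        next : addMod 1 u ≡ vert (suc (toℕ u))
        next = trans (addMod-toℕ 1 u) (cong vert (ℕₚ.+-comm (toℕ u) 1))
      f-edge (inj₂ j) eq with trans (sym (ends-chord j)) eq
      ... | refl = λ Su≡Sv → chord (toℕ j) (cong not (≡⇒xor-false Su≡Sv))

      -- `R` stands for S or its complement; `same` expresses for both that `R` lies on one side of
      -- the cut.
      f-walk : ∀ (R : VSet m) → (∀ u v → R u ≡ true → R v ≡ true → S u ≡ S v) →
               ∀ {u v} → R u ≡ true → Walk m R u v → f u ≡ f v
      f-walk R same Ru here = refl
      f-walk R same Ru (step (e , inj₁ eq) Rw p) = trans (f-edge e eq (same _ _ Ru Rw)) (f-walk R same Rw p)
      f-walk R same Ru (step (e , inj₂ eq) Rw p) = trans (sym (f-edge e eq (same _ _ Rw Ru))) (f-walk R same Rw p)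

      f≡0 : ∀ v → f v ≡ 0ℚ
      f≡0 v with S v in Sv
      ... | true  = trans (sym (f-walk S (λ _ _ p q → trans p (sym q)) (proj₂ (proj₁ bond))
              (proj₁ (proj₂ (proj₂ bond)) v₁ v (proj₂ (proj₁ bond)) Sv)))
              (trans (sym (∑-δ n f v₁)) (orth (inj₂ (inj₂ zero))))
      ... | false = trans (sym (f-walk (not ∘ S) (λ _ _ p q → Boolₚ.not-injective (trans p (sym q))) (proj₂ (proj₁ (proj₂ bond)))
              (proj₂ (proj₂ (proj₂ bond)) v₀ v (proj₂ (proj₁ (proj₂ bond))) (cong not Sv))))
              (trans (sym (∑-δ n f v₀)) (orth (inj₂ (inj₂ (suc zero)))))

    B r N : ℚ
    B = cycleSum m (cutVec m S)
    r = ∑ m (λ j → χ (needed (toℕ j)))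
    N = ∑ n (λ _ → 1ℚ)

    r+r≤B : r + r ≤ B
    r+r≤B = begin
      r + r
        ≡⟨ sym (∑-+ m (λ j → χ (needed (toℕ j))) (λ j → χ (needed (toℕ j)))) ⟩
      ∑ m (λ j → χ (needed (toℕ j)) + χ (needed (toℕ j)))
        ≤⟨ ∑-mono m (λ j → square-ineq (s (toℕ j)) (s (toℕ j ℕ.+ m)) (s (suc (toℕ j))) (s (suc (toℕ j) ℕ.+ m))) ⟩
      ∑ m (λ j → (χ (cutᶜ (toℕ j)) + χ (cutᶜ (toℕ j ℕ.+ m))) + (χ (mono (suc (toℕ j))) - χ (mono (toℕ j))))
        ≡⟨ ∑-+ m (λ j → χ (cutᶜ (toℕ j)) + χ (cutᶜ (toℕ j ℕ.+ m))) (λ j → χ (mono (suc (toℕ j))) - χ (mono (toℕ j))) ⟩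
      ∑ m (λ j → χ (cutᶜ (toℕ j)) + χ (cutᶜ (toℕ j ℕ.+ m))) + ∑ m (λ j → χ (mono (suc (toℕ j))) - χ (mono (toℕ j)))
        ≡⟨ cong₂ _+_ (trans (∑-+ m (λ j → χ (cutᶜ (toℕ j))) (λ j → χ (cutᶜ (toℕ j ℕ.+ m)))) (sym cycleSum-cut)) (∑-telescope m (χ ∘ mono)) ⟩
      B + (χ (mono m) - χ (mono 0))
        -- The telescoped difference vanishes because chord m is chord 0 with its ends exchanged.
        ≡⟨ cong (λ b → B + (χ b - χ (mono 0))) (mono-+m 0) ⟩
      B + (χ (mono 0) - χ (mono 0))
        ≡⟨ solve 2 (λ x y → x :+ (y :- y) := x) refl B (χ (mono 0)) ⟩
      B ∎
      where open ≤-Reasoning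

    total : ∑ (n ℕ.+ (m ℕ.+ 2)) (λ i → weight (map₂ (splitAt m) (splitAt n i))) ≡ N - B + (r + (1ℚ + (1ℚ + 0ℚ)))
    total = trans (∑-⊎ n (m ℕ.+ 2) (weight ∘ map₂ (splitAt m))) (cong₂ _+_
      (trans (∑-- n (λ _ → 1ℚ) (λ u → χ (cutᶜ (toℕ u)))) (cong (λ x → N - x) (sym (∑-cong n cutVec-cycle))))
      (∑-⊎ m 2 (weight ∘ inj₂)))

    -- The system has n unknowns and only the trivial solution, so n is at most its total weight: n
    -- - B uncut cycle edges, r chords and two normalizations.
    count : ∀ t₀ → cutᶜ t₀ ≡ true → N ≤ N - B + (r + (1ℚ + (1ℚ + 0ℚ)))
    count t₀ cut₀ = subst (N ≤_) total (spanning⇒weight n (row ∘ decode)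
      (λ f orth → Solution.f≡0 t₀ cut₀ f λ e → subst (λ e → ∑ n (λ v → f v * row e v) ≡ 0ℚ) (decode-encode e) (orth (encode e)))
      (weight ∘ decode) (covers ∘ decode))
      where
      decode : Fin (n ℕ.+ (m ℕ.+ 2)) → Eqn
      decode i = map₂ (splitAt m) (splitAt n i)
      encode : Eqn → Fin (n ℕ.+ (m ℕ.+ 2))
      encode e = join n (m ℕ.+ 2) (map₂ (join m 2) e)
      decode-encode : ∀ e → decode (encode e) ≡ e
      decode-encode e = trans (cong (map₂ (splitAt m)) (splitAt-join n (m ℕ.+ 2) (map₂ (join m 2) e))) (inner e)
        where
        inner : ∀ e → map₂ (splitAt m) (map₂ {A = Fin n} (join m 2) e) ≡ e
        inner (inj₁ u) = refl
        inner (inj₂ x) = cong inj₂ (splitAt-join m 2 x)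

    B≤4 : B ≤ four
    B≤4 with any? (λ (u : Fin n) → cutᶜ (toℕ u) Boolₚ.≟ true)
    -- Twice `count` plus `r+r≤B`; adding B - 2N - 2r to both sides leaves B on the left and 4 on
    -- the right.
    ... | yes (u , cut) = subst₂ _≤_
            (solve 3 (λ b r n → n :+ n :+ (r :+ r) :+ (b :- n :- n :- r :- r) := b) refl B r N)
            (solve 3 (λ b r n → n :- b :+ (r :+ (con 1ℚ :+ (con 1ℚ :+ con 0ℚ))) :+ (n :- b :+ (r :+ (con 1ℚ :+ (con 1ℚ :+ con 0ℚ)))) :+ b
                :+ (b :- n :- n :- r :- r) := con four) refl B r N)
            (+-monoˡ-≤ (B - N - N - r - r) (+-mono-≤ (+-mono-≤ (count (toℕ u) cut) (count (toℕ u) cut)) r+r≤B))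
    -- Without a cut cycle edge the induction along the chords has no start, but then B is 0.
    ... | no ¬cut = subst (_≤ four) (sym B≡0) ≤-decide
      where
      B≡0 : B ≡ 0ℚ
      B≡0 = ∑-zero n λ u → trans (cutVec-cycle u) (cong χ (Boolₚ.¬-not λ cut → ¬cut (u , cut)))

x+x≡0⇒x≡0 : ∀ x → x + x ≡ 0ℚ → x ≡ 0ℚ
x+x≡0⇒x≡0 x e = trans (solve 1 (λ x → x := con ½ :* (x :+ x)) refl x) (cong (½ *_) e)

-- Walks and connectivity

module Connectivity {m : ℕ} where

  adj-sym : ∀ {u v} → Adj m u v → Adj m v u
  adj-sym (e , p) = e , swap p

  walk-trans : ∀ {R u v w} → Walk m R u v → Walk m R v w → Walk m R u w
  walk-trans here         q = q
  walk-trans (step a r p) q = step a r (walk-trans p q)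

  -- `step` certifies only the vertex that it enters, so the first vertex must be known to lie in R
  -- before the walk can be reversed.
  walk-sym : ∀ {R u v} → R u ≡ true → Walk m R u v → Walk m R v u
  walk-sym Ru here          = here
  walk-sym Ru (step a Rw p) = walk-trans (walk-sym Rw p) (step (adj-sym a) Ru here)

  rooted⇒connected : ∀ R root → (∀ u → R u ≡ true → Walk m R u root) → InducedConnected m R
  rooted⇒connected R root to-root u v Ru Rv = walk-trans (to-root u Ru) (walk-sym Rv (to-root v Rv))

module Paths (m′ : ℕ) where
  open Wagner m′
  open Connectivity {m}

  adj-cycle : ∀ t → Adj m (vert t) (vert (suc t))
  adj-cycle t = inj₁ (vert t) , inj₁ (cong (vert t ,_) (addMod1-vert t))

  adj-chord : ∀ t → Adj m (vert t) (vert (t ℕ.+ m))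
  adj-chord = periodic m (λ t → Adj m (vert t) (vert (t ℕ.+ m)))
    (λ j → inj₂ j , inj₁ (ends-chord j))
    (λ t a → subst (Adj m (vert (t ℕ.+ m))) (sym (vert-+m+m t)) (adj-sym a))

  climb : ∀ R a d → (∀ j → j ℕ.≤ d → R (vert (j ℕ.+ a)) ≡ true) → Walk m R (vert a) (vert (d ℕ.+ a))
  climb R a zero    h = here
  climb R a (suc d) h = walk-trans (climb R a d λ j j≤d → h j (ℕₚ.m≤n⇒m≤1+n j≤d))
    (step (adj-cycle (d ℕ.+ a)) (h (suc d) ℕₚ.≤-refl) here)

-- Antipodal sets, their bonds and their cut vectors

half : Bool → ℕ → Bool
half b zero          = true
half b (suc zero)    = b
half b (suc (suc _)) = false

half-suc : ∀ b t → half b t ≡ false → half b (suc t) ≡ false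
half-suc b (suc t) _ = refl

-- The pattern never returns once it is false, which keeps the upward walks of `ascend` inside the
-- complement.
half-+ : ∀ b j t → half b t ≡ false → half b (j ℕ.+ t) ≡ false
half-+ b zero    t h = h
half-+ b (suc j) t h = half-suc b (j ℕ.+ t) (half-+ b j t h)

module Face (k : ℕ) where
  open Wagner (suc (suc k)) public
  open Connectivity {m}
  open Paths (suc (suc k))

  -- `top` is m - 1, the last position of a half of the cycle. It is at least 2, so it lies outside
  -- the pattern `half` for either value of the flag.
  n-1 top : ℕ
  n-1 = suc (suc k) ℕ.+ m
  top = suc (suc k)

  -- Subtracting i modulo n is adding i (n - 1).
  offset : ℕ → Vert m → ℕ
  offset i u = toℕ (addMod (i ℕ.* n-1) u)

  offset-vert : ∀ i t → t ℕ.< n → offset i (vert (t ℕ.+ i)) ≡ t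
  offset-vert i t t<n = begin
    toℕ (addMod (i ℕ.* n-1) (vert (t ℕ.+ i)))  ≡⟨ cong toℕ (addMod-vert (i ℕ.* n-1) (t ℕ.+ i)) ⟩
    toℕ (vert (t ℕ.+ i ℕ.+ i ℕ.* n-1))         ≡⟨ toℕ-vert (t ℕ.+ i ℕ.+ i ℕ.* n-1) ⟩
    (t ℕ.+ i ℕ.+ i ℕ.* n-1) % n                ≡⟨ cong (_% n) (trans (ℕₚ.+-assoc t i _) (cong (t ℕ.+_) (sym (ℕₚ.*-suc i n-1)))) ⟩
    (t ℕ.+ i ℕ.* n) % n                        ≡⟨ [m+kn]%n≡m%n t i n ⟩
    t % n                                      ≡⟨ m<n⇒m%n≡m t<n ⟩
    t                                          ∎
    where open ≡-Reasoning

  vert-offset : ∀ i u → vert (offset i u ℕ.+ i) ≡ u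
  vert-offset i u = begin
    addMod i (addMod (i ℕ.* n-1) u)       ≡⟨ cong (addMod i) (addMod-toℕ (i ℕ.* n-1) u) ⟩
    addMod i (vert (toℕ u ℕ.+ i ℕ.* n-1)) ≡⟨ addMod-vert i (toℕ u ℕ.+ i ℕ.* n-1) ⟩
    vert (toℕ u ℕ.+ i ℕ.* n-1 ℕ.+ i)      ≡⟨ cong vert (trans (ℕₚ.+-assoc (toℕ u) _ i) (cong (toℕ u ℕ.+_) (trans (ℕₚ.+-comm (i ℕ.* n-1) i) (sym (ℕₚ.*-suc i n-1))))) ⟩
    vert (toℕ u ℕ.+ i ℕ.* n)              ≡⟨ vert-cong (toℕ u ℕ.+ i ℕ.* n) (toℕ u) ([m+kn]%n≡m%n (toℕ u) i n) ⟩
    vert (toℕ u)                          ≡⟨ vert-toℕ u ⟩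
    u                                     ∎
    where open ≡-Reasoning

  arcs : Bool → Bool → ℕ → Bool
  arcs b c t with t ℕ.<? m
  ... | yes _ = half b t
  ... | no  _ = half c (t ℕ.∸ m)

  arcs-lo : ∀ b c t → t ℕ.< m → arcs b c t ≡ half b t
  arcs-lo b c t t<m with t ℕ.<? m
  ... | yes _   = refl
  ... | no  t≮m = contradiction t<m t≮m

  arcs-hi : ∀ b c t → arcs b c (t ℕ.+ m) ≡ half c t
  arcs-hi b c t with t ℕ.+ m ℕ.<? m
  ... | yes lt = contradiction lt (ℕₚ.≤⇒≯ (ℕₚ.m≤n+m m t))
  ... | no  _  = cong (half c) (ℕₚ.m+n∸n≡m t m)

  -- { i , i + m } together with i + 1 if b, and i + m + 1 if c.
  antipodal : Bool → Bool → ℕ → VSet m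
  antipodal b c i u = arcs b c (offset i u)

  -- Lets orthogonality to the cuts with i in `Fin n` be extended to all natural i by `periodic`.
  antipodal-+n : ∀ b c i u → antipodal b c (i ℕ.+ n) u ≡ antipodal b c i u
  antipodal-+n b c i u = cong (arcs b c) eq
    where
    open ≡-Reasoning
    eq : offset (i ℕ.+ n) u ≡ offset i u
    eq = cong toℕ (vert-cong (toℕ u ℕ.+ (i ℕ.+ n) ℕ.* n-1) (toℕ u ℕ.+ i ℕ.* n-1) (begin
      (toℕ u ℕ.+ (i ℕ.+ n) ℕ.* n-1) % n
        ≡⟨ cong (λ x → (toℕ u ℕ.+ x) % n) (trans (ℕₚ.*-distribʳ-+ n-1 i n) (cong (i ℕ.* n-1 ℕ.+_) (ℕₚ.*-comm n n-1))) ⟩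
      (toℕ u ℕ.+ (i ℕ.* n-1 ℕ.+ n-1 ℕ.* n)) % n
        ≡⟨ cong (_% n) (sym (ℕₚ.+-assoc (toℕ u) (i ℕ.* n-1) (n-1 ℕ.* n))) ⟩
      (toℕ u ℕ.+ i ℕ.* n-1 ℕ.+ n-1 ℕ.* n) % n
        ≡⟨ [m+kn]%n≡m%n (toℕ u ℕ.+ i ℕ.* n-1) n-1 n ⟩
      (toℕ u ℕ.+ i ℕ.* n-1) % n ∎))

  module Antipodal (b c : Bool) (i : ℕ) where

    S : VSet m
    S = antipodal b c i

    open Cut S public

    s-lo : ∀ t → t ℕ.< m → s (t ℕ.+ i) ≡ half b t
    s-lo t t<m = trans (cong (arcs b c) (offset-vert i t (ℕₚ.<-≤-trans t<m (ℕₚ.m≤m+n m m)))) (arcs-lo b c t t<m)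

    s-hi : ∀ t → t ℕ.< m → s (t ℕ.+ (i ℕ.+ m)) ≡ half c t
    s-hi t t<m = begin
      s (t ℕ.+ (i ℕ.+ m))             ≡⟨ cong (λ x → s (t ℕ.+ x)) (ℕₚ.+-comm i m) ⟩
      s (t ℕ.+ (m ℕ.+ i))             ≡⟨ cong s (sym (ℕₚ.+-assoc t m i)) ⟩
      s (t ℕ.+ m ℕ.+ i)               ≡⟨ cong (arcs b c) (offset-vert i (t ℕ.+ m) (ℕₚ.+-monoˡ-< m t<m)) ⟩
      arcs b c (t ℕ.+ m)              ≡⟨ arcs-hi b c t ⟩
      half c t                        ∎
      where open ≡-Reasoning

    s-lo-end : s (m ℕ.+ i) ≡ true
    s-lo-end = trans (cong s (ℕₚ.+-comm m i)) (s-hi 0 (s≤s z≤n))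

    s-hi-end : s (m ℕ.+ (i ℕ.+ m)) ≡ true
    s-hi-end = trans (cong s (ℕₚ.+-comm m (i ℕ.+ m))) (trans (s-+m+m i) (s-lo 0 (s≤s z≤n)))

    locate : ∀ u → Σ ℕ λ t → t ℕ.< m × (u ≡ vert (t ℕ.+ i) ⊎ u ≡ vert (t ℕ.+ (i ℕ.+ m)))
    locate u with offset i u ℕ.<? m
    ... | yes lt = offset i u , lt , inj₁ (sym (vert-offset i u))
    ... | no  ge = t , ℕₚ.+-cancelʳ-< m t m (subst (ℕ._< n) (sym split) (toℕ<n (addMod (i ℕ.* n-1) u))) , inj₂ (begin
        u                           ≡⟨ sym (vert-offset i u) ⟩
        vert (offset i u ℕ.+ i)     ≡⟨ cong (λ x → vert (x ℕ.+ i)) (sym split) ⟩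
        vert (t ℕ.+ m ℕ.+ i)        ≡⟨ cong vert (trans (ℕₚ.+-assoc t m i) (cong (t ℕ.+_) (ℕₚ.+-comm m i))) ⟩
        vert (t ℕ.+ (i ℕ.+ m))      ∎)
      where
      open ≡-Reasoning
      t = offset i u ℕ.∸ m
      split : t ℕ.+ m ≡ offset i u
      split = ℕₚ.m∸n+n≡m (ℕₚ.≮⇒≥ ge)

    top<m : top ℕ.< m
    top<m = ℕₚ.≤-refl

    descend : ∀ h x → (∀ t → t ℕ.< m → s (t ℕ.+ x) ≡ half h t) → ∀ t → t ℕ.< m → half h t ≡ true → Walk m S (vert (t ℕ.+ x)) (vert x)
    descend h x shape zero       _ _ = here
    descend h x shape (suc zero) _ _ = step (adj-sym (adj-cycle x)) (shape 0 (s≤s z≤n)) here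

    ascend : ∀ h x → (∀ t → t ℕ.< m → s (t ℕ.+ x) ≡ half h t) → ∀ t → t ℕ.< m → half h t ≡ false →
             Walk m (not ∘ S) (vert (t ℕ.+ x)) (vert (top ℕ.+ x))
    ascend h x shape t t<m off = subst (λ y → Walk m (not ∘ S) (vert (t ℕ.+ x)) (vert y)) end
      (climb (not ∘ S) (t ℕ.+ x) d λ j j≤d → cong not (trans (cong s (sym (ℕₚ.+-assoc j t x)))
        (trans (shape (j ℕ.+ t) (s≤s (subst (j ℕ.+ t ℕ.≤_) d+t (ℕₚ.+-monoˡ-≤ t j≤d)))) (half-+ h j t off))))
      where
      d = top ℕ.∸ t
      d+t : d ℕ.+ t ≡ top
      d+t = ℕₚ.m∸n+n≡m (ℕₚ.≤-pred t<m)
      end : d ℕ.+ (t ℕ.+ x) ≡ top ℕ.+ x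
      end = trans (sym (ℕₚ.+-assoc d t x)) (cong (ℕ._+ x) d+t)

    -- Within its half each vertex of S descends to the first position, and the chord {i, i + m}
    -- joins the two first positions.
    to-bottom : ∀ u → S u ≡ true → Walk m S u (vert i)
    to-bottom u Su with locate u
    ... | t , t<m , inj₁ refl = descend b i s-lo t t<m (trans (sym (s-lo t t<m)) Su)
    ... | t , t<m , inj₂ refl = walk-trans (descend c (i ℕ.+ m) s-hi t t<m (trans (sym (s-hi t t<m)) Su))
            (step (adj-sym (adj-chord i)) (s-lo 0 (s≤s z≤n)) here)

    -- Within its half each vertex of the complement climbs to the last position; the chord between
    -- the two last positions joins the halves.
    to-top : ∀ u → not (S u) ≡ true → Walk m (not ∘ S) u (vert (top ℕ.+ i))
    to-top u Su with locate u
    ... | t , t<m , inj₁ refl = ascend b i s-lo t t<m (trans (sym (s-lo t t<m)) (Boolₚ.not-injective Su))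
    ... | t , t<m , inj₂ refl = walk-trans (ascend c (i ℕ.+ m) s-hi t t<m (trans (sym (s-hi t t<m)) (Boolₚ.not-injective Su)))
            (step (adj-sym (subst (λ x → Adj m (vert (top ℕ.+ i)) (vert x)) (ℕₚ.+-assoc top i m) (adj-chord (top ℕ.+ i))))
              (cong not (s-lo top top<m)) here)

    bond : IsBond m S
    bond = (vert i , s-lo 0 (s≤s z≤n)) , (vert (top ℕ.+ i) , cong not (s-lo top top<m))
         , rooted⇒connected S (vert i) to-bottom , rooted⇒connected (not ∘ S) (vert (top ℕ.+ i)) to-top

    -- Two cycle edges of each half are cut: the one where the pattern drops, at position 0 or 1
    -- according to h, and the one from `top` into the next half, whose first vertex is in S.
    half-sum : ∀ h x → (∀ t → t ℕ.< m → s (t ℕ.+ x) ≡ half h t) → s (m ℕ.+ x) ≡ true → (z : ℕ → ℚ) →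
      ∑ m (λ j → z (toℕ j ℕ.+ x) * χ (cutᶜ (toℕ j ℕ.+ x))) ≡ z x * χ (not h) + (z (suc x) * χ h + z (top ℕ.+ x))
    half-sum h x shape end z = cong₂ _+_
      (cong (λ b → z x * χ b) (cong₂ _xor_ (shape 0 (s≤s z≤n)) (shape 1 (s≤s (s≤s z≤n)))))
      (cong₂ _+_
        (cong (λ b → z (suc x) * χ b) (trans (cong₂ _xor_ (shape 1 (s≤s (s≤s z≤n))) (shape 2 (s≤s (s≤s (s≤s z≤n))))) (Boolₚ.xor-identityʳ h)))
        (begin
          -- These are positions 2 to `top`; all edges but the last join two vertices outside S.
          ∑ (suc k) (λ j → G (toℕ j))
            ≡⟨ ∑-last k G ⟩
          ∑ k (λ j → G (toℕ j)) + G k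
            ≡⟨ cong₂ _+_ (∑-zero k λ j → trans (cong (λ b → z (2 ℕ.+ toℕ j ℕ.+ x) * χ b)
                  (cong₂ _xor_ (shape (2 ℕ.+ toℕ j) (s≤s (s≤s (ℕₚ.m≤n⇒m≤1+n (toℕ<n j))))) (shape (3 ℕ.+ toℕ j) (s≤s (s≤s (s≤s (toℕ<n j)))))))
                  (*-zeroʳ (z (2 ℕ.+ toℕ j ℕ.+ x))))
                (cong (λ b → z (top ℕ.+ x) * χ b) (cong₂ _xor_ (shape top top<m) end)) ⟩
          0ℚ + z (top ℕ.+ x) * 1ℚ
            ≡⟨ solve 1 (λ z → con 0ℚ :+ z :* con 1ℚ := z) refl (z (top ℕ.+ x)) ⟩
          z (top ℕ.+ x) ∎))
      where
      open ≡-Reasoning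
      G : ℕ → ℚ
      G t = z (2 ℕ.+ t ℕ.+ x) * χ (cutᶜ (2 ℕ.+ t ℕ.+ x))

    cycle-dot : ∀ (z : ℕ → ℚ) → (∀ t → z (t ℕ.+ n) ≡ z t) →
      ∑ n (λ u → z (toℕ u) * cutVec m S (inj₁ u)) ≡
        (z i * χ (not b) + (z (suc i) * χ b + z (top ℕ.+ i))) +
        (z (i ℕ.+ m) * χ (not c) + (z (suc (i ℕ.+ m)) * χ c + z (top ℕ.+ (i ℕ.+ m))))
    cycle-dot z per = begin
      ∑ n (λ u → z (toℕ u) * cutVec m S (inj₁ u))
        ≡⟨ ∑-cong n (λ u → cong (z (toℕ u) *_) (cutVec-cycle u)) ⟩
      ∑ n (g ∘ toℕ)
        ≡⟨ sym (∑-rotate n g (λ t → cong₂ (λ x b → x * χ b) (per t) (cong₂ _xor_ (cong S (vert-+n t)) (cong S (vert-+n (suc t))))) i) ⟩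
      ∑ n (λ u → g (toℕ u ℕ.+ i))
        ≡⟨ ∑-halves (λ t → g (t ℕ.+ i)) ⟩
      ∑ m (λ j → g (toℕ j ℕ.+ i)) + ∑ m (λ j → g (toℕ j ℕ.+ m ℕ.+ i))
        ≡⟨ cong₂ _+_ (half-sum b i s-lo s-lo-end z)
             (trans (∑-cong m λ j → cong g (trans (ℕₚ.+-assoc (toℕ j) m i) (cong (toℕ j ℕ.+_) (ℕₚ.+-comm m i))))
                    (half-sum c (i ℕ.+ m) s-hi s-hi-end z)) ⟩
      _ ∎
      where
      open ≡-Reasoning
      g : ℕ → ℚ
      g t = z t * χ (cutᶜ t)

    -- The patterns of the two halves can differ only at position 1, so chord i + 1 is the only one
    -- that may be cut.
    chord-dot : ∀ (w : ℕ → ℚ) → (∀ t → w (t ℕ.+ m) ≡ w t) →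
      ∑ m (λ j → w (toℕ j) * cutVec m S (inj₂ j)) ≡ w (suc i) * χ (b xor c)
    chord-dot w per = begin
      ∑ m (λ j → w (toℕ j) * cutVec m S (inj₂ j))
        ≡⟨ ∑-cong m (λ j → cong (w (toℕ j) *_) (cutVec-chord j)) ⟩
      ∑ m (g ∘ toℕ)
        ≡⟨ sym (∑-rotate m g (λ t → cong₂ (λ x b → x * χ b) (per t)
             (trans (cong (s (t ℕ.+ m) xor_) (s-+m+m t)) (xor-comm (s (t ℕ.+ m)) (s t)))) i) ⟩
      ∑ m (λ j → g (toℕ j ℕ.+ i))
        ≡⟨ ∑-cong m (λ j → cong (λ b → w (toℕ j ℕ.+ i) * χ b) (cong₂ _xor_ (s-lo (toℕ j) (toℕ<n j))
             (trans (cong s (ℕₚ.+-assoc (toℕ j) i m)) (s-hi (toℕ j) (toℕ<n j))))) ⟩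
      w i * 0ℚ + (w (suc i) * χ (b xor c) + ∑ (suc k) (λ j → w (2 ℕ.+ toℕ j ℕ.+ i) * 0ℚ))
        ≡⟨ cong (λ x → w i * 0ℚ + (w (suc i) * χ (b xor c) + x)) (∑-zero (suc k) λ j → *-zeroʳ (w (2 ℕ.+ toℕ j ℕ.+ i))) ⟩
      w i * 0ℚ + (w (suc i) * χ (b xor c) + 0ℚ)
        ≡⟨ solve 2 (λ x y → x :* con 0ℚ :+ (y :+ con 0ℚ) := y) refl (w i) (w (suc i) * χ (b xor c)) ⟩
      w (suc i) * χ (b xor c) ∎
      where
      open ≡-Reasoning
      g : ℕ → ℚ
      g t = w t * χ (s t xor s (t ℕ.+ m))

    cycleSum≡4 : cycleSum m (cutVec m S) ≡ four
    cycleSum≡4 = trans (∑-cong n λ u → sym (*-identityˡ (cutVec m S (inj₁ u))))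
      (trans (cycle-dot (λ _ → 1ℚ) (λ _ → refl)) (value b c))
      where
      value : ∀ b c → (1ℚ * χ (not b) + (1ℚ * χ b + 1ℚ)) + (1ℚ * χ (not c) + (1ℚ * χ c + 1ℚ)) ≡ four
      value true  true  = refl
      value true  false = refl
      value false true  = refl
      value false false = refl

  -- Spanning by antipodal cuts

  dot : Point m → Point m → ℚ
  dot x y = ∑ n (λ u → x (inj₁ u) * y (inj₁ u)) + ∑ m (λ j → x (inj₂ j) * y (inj₂ j))

  cutVec-cong : ∀ {S T : VSet m} → (∀ u → S u ≡ T u) → ∀ e → cutVec m S e ≡ cutVec m T e
  cutVec-cong h (inj₁ u) = cong χ (cong₂ _xor_ (h u) (h (addMod 1 u)))
  cutVec-cong h (inj₂ j) = cong χ (cong₂ _xor_ (h (j ↑ˡ m)) (h (addMod m (j ↑ˡ m))))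

  -- The condition on b and c excludes only `false , true`, which leaves the three kinds of sets.
  module Annihilator (x : Point m) (orth : ∀ b c → b ∨ not c ≡ true → ∀ (i : Fin n) → dot x (cutVec m (antipodal b c (toℕ i))) ≡ 0ℚ) where
    open ≡-Reasoning

    z w P : ℕ → ℚ
    z t = x (inj₁ (vert t))
    w t = x (inj₂ (t mod m))
    P t = z t + z (t ℕ.+ m)

    z-+n : ∀ t → z (t ℕ.+ n) ≡ z t
    z-+n t = cong (x ∘ inj₁) (vert-+n t)

    w-+m : ∀ t → w (t ℕ.+ m) ≡ w t
    w-+m t = cong (x ∘ inj₂) (toℕ-injective (trans (toℕ-fromℕ< (m%n<n (t ℕ.+ m) m)) (trans ([m+n]%n≡m%n t m) (sym (toℕ-fromℕ< (m%n<n t m))))))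

    mod-toℕ : ∀ (j : Fin m) → toℕ j mod m ≡ j
    mod-toℕ j = toℕ-injective (trans (toℕ-fromℕ< (m%n<n (toℕ j) m)) (m<n⇒m%n≡m (toℕ<n j)))

    orth-ℕ : ∀ b c → b ∨ not c ≡ true → ∀ i → dot x (cutVec m (antipodal b c i)) ≡ 0ℚ
    orth-ℕ b c ok = periodic n (λ i → dot x (cutVec m (antipodal b c i)) ≡ 0ℚ) (orth b c ok) λ i h →
      trans (cong₂ _+_ (∑-cong n λ u → cong (x (inj₁ u) *_) (cutVec-cong (antipodal-+n b c i) (inj₁ u)))
                       (∑-cong m λ j → cong (x (inj₂ j) *_) (cutVec-cong (antipodal-+n b c i) (inj₂ j)))) h

    equation : ∀ b c → b ∨ not c ≡ true → ∀ i →
      (z i * χ (not b) + (z (suc i) * χ b + z (top ℕ.+ i))) +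
      (z (i ℕ.+ m) * χ (not c) + (z (suc (i ℕ.+ m)) * χ c + z (top ℕ.+ i ℕ.+ m))) + w (suc i) * χ (b xor c) ≡ 0ℚ
    equation b c ok i = begin
      -- Reassociating the last index makes the summands of `P (top ℕ.+ i)` appear literally.
      _ ≡⟨ cong (λ t → (z i * χ (not b) + (z (suc i) * χ b + z (top ℕ.+ i))) +
             (z (i ℕ.+ m) * χ (not c) + (z (suc (i ℕ.+ m)) * χ c + z t)) + w (suc i) * χ (b xor c)) (ℕₚ.+-assoc top i m) ⟩
      _ ≡⟨ sym (cong₂ _+_
             (trans (∑-cong n λ u → cong (λ v → x (inj₁ v) * cutVec m (antipodal b c i) (inj₁ u)) (sym (vert-toℕ u)))
                    (Antipodal.cycle-dot b c i z z-+n))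
             (trans (∑-cong m λ j → cong (λ v → x (inj₂ v) * cutVec m (antipodal b c i) (inj₂ j)) (sym (mod-toℕ j)))
                    (Antipodal.chord-dot b c i w w-+m))) ⟩
      dot x (cutVec m (antipodal b c i)) ≡⟨ orth-ℕ b c ok i ⟩
      0ℚ ∎

    P-pair : ∀ i → P i + P (top ℕ.+ i) ≡ 0ℚ
    P-pair i = trans (solve 7 (λ z₀ z₁ z₂ y₀ y₁ y₂ w → z₀ :+ y₀ :+ (z₂ :+ y₂) :=
        (z₀ :* con 1ℚ :+ (z₁ :* con 0ℚ :+ z₂)) :+ (y₀ :* con 1ℚ :+ (y₁ :* con 0ℚ :+ y₂)) :+ w :* con 0ℚ) refl
        (z i) (z (suc i)) (z (top ℕ.+ i)) (z (i ℕ.+ m)) (z (suc (i ℕ.+ m))) (z (top ℕ.+ i ℕ.+ m)) (w (suc i)))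
      (equation false false refl i)

    P-pair′ : ∀ i → P (suc i) + P (top ℕ.+ i) ≡ 0ℚ
    P-pair′ i = trans (solve 7 (λ z₀ z₁ z₂ y₀ y₁ y₂ w → z₁ :+ y₁ :+ (z₂ :+ y₂) :=
        (z₀ :* con 0ℚ :+ (z₁ :* con 1ℚ :+ z₂)) :+ (y₀ :* con 0ℚ :+ (y₁ :* con 1ℚ :+ y₂)) :+ w :* con 0ℚ) refl
        (z i) (z (suc i)) (z (top ℕ.+ i)) (z (i ℕ.+ m)) (z (suc (i ℕ.+ m))) (z (top ℕ.+ i ℕ.+ m)) (w (suc i)))
      (equation true true refl i)

    mixed : ∀ i → z (suc i) + z (i ℕ.+ m) + P (top ℕ.+ i) + w (suc i) ≡ 0ℚ
    mixed i = trans (solve 7 (λ z₀ z₁ z₂ y₀ y₁ y₂ w → z₁ :+ y₀ :+ (z₂ :+ y₂) :+ w :=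
        (z₀ :* con 0ℚ :+ (z₁ :* con 1ℚ :+ z₂)) :+ (y₀ :* con 1ℚ :+ (y₁ :* con 0ℚ :+ y₂)) :+ w :* con 1ℚ) refl
        (z i) (z (suc i)) (z (top ℕ.+ i)) (z (i ℕ.+ m)) (z (suc (i ℕ.+ m))) (z (top ℕ.+ i ℕ.+ m)) (w (suc i)))
      (equation true false refl i)

    constant : ∀ (g : ℕ → ℚ) → (∀ i → g (suc i) ≡ g i) → ∀ d i → g (d ℕ.+ i) ≡ g i
    constant g h zero    i = refl
    constant g h (suc d) i = trans (h (d ℕ.+ i)) (constant g h d i)

    P-suc : ∀ i → P (suc i) ≡ P i
    P-suc i = begin
      P (suc i)                                    ≡⟨ solve 2 (λ a b → a := (a :+ b) :- b) refl (P (suc i)) (P (top ℕ.+ i)) ⟩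
      P (suc i) + P (top ℕ.+ i) - P (top ℕ.+ i)    ≡⟨ cong (_- P (top ℕ.+ i)) (trans (P-pair′ i) (sym (P-pair i))) ⟩
      P i + P (top ℕ.+ i) - P (top ℕ.+ i)          ≡⟨ solve 2 (λ a b → (a :+ b) :- b := a) refl (P i) (P (top ℕ.+ i)) ⟩
      P i                                          ∎

    P≡0 : ∀ i → P i ≡ 0ℚ
    P≡0 i = x+x≡0⇒x≡0 (P i) (trans (cong (P i +_) (sym (constant P P-suc top i))) (P-pair i))

    mixed′ : ∀ i → z (suc i) - z i + w (suc i) ≡ 0ℚ
    mixed′ i = begin
      z (suc i) - z i + w (suc i)
        ≡⟨ solve 5 (λ a b c p w → a :- b :+ w := a :+ c :+ p :+ w :- (b :+ c) :- p) refl (z (suc i)) (z i) (z (i ℕ.+ m)) (P (top ℕ.+ i)) (w (suc i)) ⟩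
      z (suc i) + z (i ℕ.+ m) + P (top ℕ.+ i) + w (suc i) - P i - P (top ℕ.+ i)
        ≡⟨ cong₂ _-_ (cong₂ _-_ (mixed i) (P≡0 i)) (P≡0 (top ℕ.+ i)) ⟩
      0ℚ ∎

    w-suc≡0 : ∀ i → w (suc i) ≡ 0ℚ
    w-suc≡0 i = x+x≡0⇒x≡0 (w (suc i)) (begin
      w (suc i) + w (suc i)
        ≡⟨ solve 5 (λ a b a′ b′ w → w :+ w := (a :- b :+ w) :+ (a′ :- b′ :+ w) :- (a :+ a′) :+ (b :+ b′)) refl (z (suc i)) (z i) (z (suc i ℕ.+ m)) (z (i ℕ.+ m)) (w (suc i)) ⟩
      (z (suc i) - z i + w (suc i)) + (z (suc i ℕ.+ m) - z (i ℕ.+ m) + w (suc i)) - P (suc i) + P i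
        -- The relation `mixed′` at i + m involves the same chord weight as at i, so the two add up
        -- to twice that weight once P = 0 removes the z terms.
        ≡⟨ cong (λ y → (z (suc i) - z i + w (suc i)) + (z (suc i ℕ.+ m) - z (i ℕ.+ m) + y) - P (suc i) + P i) (sym (w-+m (suc i))) ⟩
      (z (suc i) - z i + w (suc i)) + (z (suc i ℕ.+ m) - z (i ℕ.+ m) + w (suc i ℕ.+ m)) - P (suc i) + P i
        ≡⟨ cong₂ _+_ (cong₂ _-_ (cong₂ _+_ (mixed′ i) (mixed′ (i ℕ.+ m))) (P≡0 (suc i))) (P≡0 i) ⟩
      0ℚ ∎)

    w≡0 : ∀ t → w t ≡ 0ℚ
    -- Chord 0 is also chord m, and m is the successor of `top`.
    w≡0 zero    = trans (sym (w-+m 0)) (w-suc≡0 top)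
    w≡0 (suc t) = w-suc≡0 t

    z-suc : ∀ i → z (suc i) ≡ z i
    z-suc i = x-y≡0⇒x≡y (z (suc i)) (z i) (begin
      z (suc i) - z i                ≡⟨ sym (+-identityʳ (z (suc i) - z i)) ⟩
      z (suc i) - z i + 0ℚ           ≡⟨ cong (z (suc i) - z i +_) (sym (w-suc≡0 i)) ⟩
      z (suc i) - z i + w (suc i)    ≡⟨ mixed′ i ⟩
      0ℚ                             ∎)

    z≡0 : ∀ i → z i ≡ 0ℚ
    z≡0 i = x+x≡0⇒x≡0 (z i) (trans (cong (z i +_) (trans (sym (constant z z-suc m i)) (cong z (ℕₚ.+-comm m i)))) (P≡0 i))

    x≡0 : ∀ e → x e ≡ 0ℚ
    x≡0 (inj₁ u) = trans (cong (x ∘ inj₁) (sym (vert-toℕ u))) (z≡0 (toℕ u))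
    x≡0 (inj₂ j) = trans (cong (x ∘ inj₂) (sym (mod-toℕ j))) (w≡0 (toℕ j))

  -- The star of a single vertex

  singleton : VSet m
  singleton zero    = true
  singleton (suc _) = false

  module Singleton where
    open Cut singleton

    s-off : ∀ t → suc t ℕ.< n → s (suc t) ≡ false
    s-off t lt = aux (vert (suc t)) (trans (toℕ-vert (suc t)) (m<n⇒m%n≡m lt))
      where
      aux : ∀ (v : Vert m) → toℕ v ≡ suc t → singleton v ≡ false
      aux (suc _) _ = refl

    s-n : s n ≡ true
    s-n = trans (cong singleton (vert-+n 0)) refl

    -- Deleting vertex 0 from the outer cycle leaves a path, along which every other vertex climbs
    -- to n - 1.
    to-top : ∀ u → not (singleton u) ≡ true → Walk m (not ∘ singleton) u (vert n-1)
    to-top u@(suc v) _ = subst₂ (Walk m (not ∘ singleton)) (vert-toℕ u) (cong vert d+t)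
      (climb (not ∘ singleton) (toℕ u) d λ j j≤d → cong not (trans (cong s (ℕₚ.+-suc j (toℕ v)))
        (s-off (j ℕ.+ toℕ v) (s≤s (subst (ℕ._≤ n-1) (ℕₚ.+-suc j (toℕ v)) (subst (j ℕ.+ toℕ u ℕ.≤_) d+t (ℕₚ.+-monoˡ-≤ (toℕ u) j≤d)))))))
      where
      d = n-1 ℕ.∸ toℕ u
      d+t : d ℕ.+ toℕ u ≡ n-1
      d+t = ℕₚ.m∸n+n≡m (ℕₚ.≤-pred (toℕ<n u))

    bond : IsBond m singleton
    bond = (zero , refl) , (suc zero , refl) , (λ { zero zero _ _ → here }) , rooted⇒connected (not ∘ singleton) (vert n-1) to-top

    cycleSum≡2 : cycleSum m (cutVec m singleton) ≡ 1ℚ + 1ℚ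
    cycleSum≡2 = trans (∑-cong n cutVec-cycle) (cong₂ _+_
      (cong (λ b → χ (true xor b)) (s-off 0 (s≤s (s≤s z≤n))))
      (trans (∑-last l (λ t → χ (cutᶜ (suc t)))) (cong₂ _+_
        (∑-zero l λ j → cong χ (cong₂ _xor_ (s-off (toℕ j) (s≤s (s≤s (ℕₚ.<⇒≤ (toℕ<n j))))) (s-off (suc (toℕ j)) (s≤s (s≤s (toℕ<n j))))))
        (cong χ (cong₂ _xor_ (s-off l ℕₚ.≤-refl) s-n)))))
      where
      -- `l` is n - 2, so edge l + 1 is the last cycle edge, from n - 1 back to 0.
      l : ℕ
      l = suc k ℕ.+ m

  -- Dimensions

  D : ℕ
  D = n ℕ.+ m

  toVec : Point m → Fin D → ℚ
  toVec x e = x (splitAt n e)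

  cycleSum-∑ : ∀ K (c : Fin K → ℚ) (p : Fin K → Point m) →
    cycleSum m (λ e → ∑ K (λ i → c i * p i e)) ≡ ∑ K (λ i → c i * cycleSum m (p i))
  cycleSum-∑ K c p = trans (∑-swap n K (λ u i → c i * p i (inj₁ u))) (∑-cong K λ i → ∑-* n (c i) (λ u → p i (inj₁ u)))

  cut∈Bond : ∀ S → IsBond m S → InBond m (cutVec m S)
  cut∈Bond S bond = 1 , (λ _ → S) , (λ _ → 1ℚ) , (λ _ → bond) , (λ _ → ≤-decide) , refl ,
    λ e → solve 1 (λ x → x := con 1ℚ :* x :+ con 0ℚ) refl (cutVec m S e)

  valid : ∀ x → InBond m x → cycleSum m x ≤ four
  valid x (K , S , λs , bonds , λ≥0 , ∑λ≡1 , x≡) = begin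
    cycleSum m x                                              ≡⟨ ∑-cong n (λ u → x≡ (inj₁ u)) ⟩
    cycleSum m (λ e → ∑ K (λ i → λs i * cutVec m (S i) e))    ≡⟨ cycleSum-∑ K λs (λ i → cutVec m (S i)) ⟩
    ∑ K (λ i → λs i * cycleSum m (cutVec m (S i)))            ≤⟨ ∑-mono K (λ i → *-monoˡ-≤-nonNeg (λs i) {{nonNegative (λ≥0 i)}} (Bound.B≤4 (S i) (bonds i))) ⟩
    ∑ K (λ i → λs i * four)                                   ≡⟨ ∑-cong K (λ i → *-comm (λs i) four) ⟩
    ∑ K (λ i → four * λs i)                                   ≡⟨ ∑-* K four λs ⟩
    four * ∑ K λs                                             ≡⟨ cong (four *_) ∑λ≡1 ⟩
    four * 1ℚ                                                 ≡⟨ *-identityʳ four ⟩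
    four                                                      ∎
    where open ≤-Reasoning

  OnFace : Point m → Set
  OnFace x = InBond m x × (cycleSum m x ≡ four)

  kind : Fin 3 → Bool × Bool
  kind zero             = false , false
  kind (suc zero)       = true , true
  kind (suc (suc zero)) = true , false

  kind-onto : ∀ b c → b ∨ not c ≡ true → ∃ λ j → kind j ≡ (b , c)
  kind-onto false false _ = zero , refl
  kind-onto true  true  _ = suc zero , refl
  kind-onto true  false _ = suc (suc zero) , refl

  family : Fin 3 × Fin n → Point m
  family (j , i) = cutVec m (antipodal (proj₁ (kind j)) (proj₂ (kind j)) (toℕ i))

  spanning : ∀ {K} (decode : Fin K → Fin 3 × Fin n) (encode : Fin 3 × Fin n → Fin K) → (∀ q → decode (encode q) ≡ q) →
             Spanning (λ i → toVec (family (decode i)))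
  spanning decode encode inv a orth e = trans (cong a (sym (join-splitAt n m e))) (Annihilator.x≡0 x orth′ (splitAt n e))
    where
    x : Point m
    x = a ∘ join n m
    dot≡ : ∀ y → ∑ D (λ e → a e * toVec y e) ≡ dot x y
    dot≡ y = trans (∑-cong D λ e → cong (λ e′ → a e′ * toVec y e) (sym (join-splitAt n m e))) (∑-⊎ n m (λ e → x e * y e))
    orth-family : ∀ q → dot x (family q) ≡ 0ℚ
    orth-family q = subst (λ q → dot x (family q) ≡ 0ℚ) (inv q) (trans (sym (dot≡ (family (decode (encode q))))) (orth (encode q)))
    orth′ : ∀ b c → b ∨ not c ≡ true → ∀ i → dot x (cutVec m (antipodal b c (toℕ i))) ≡ 0ℚ
    orth′ b c ok i = subst (λ bc → dot x (cutVec m (antipodal (proj₁ bc) (proj₂ bc) (toℕ i))) ≡ 0ℚ)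
      (proj₂ (kind-onto b c ok)) (orth-family (proj₁ (kind-onto b c ok) , i))

  -- Elimination selects from the 3n cuts as many linearly independent ones as the graph has edges.
  basis : Σ (Fin D → Fin 3 × Fin n) λ σ → Independent (λ i → toVec (family (σ i)))
  basis = remQuot {3} n ∘ proj₁ found , proj₂ found
    where
    found = spanning⇒basis D (λ i → toVec (family (remQuot {3} n i)))
      (spanning (remQuot {3} n) (λ q → combine (proj₁ q) (proj₂ q)) (λ q → remQuot-combine (proj₁ q) (proj₂ q)))

  facePoint : Fin D → Point m
  facePoint i = family (proj₁ basis i)

  family-onFace : ∀ q → OnFace (family q)
  family-onFace (j , i) = cut∈Bond _ (Antipodal.bond b c (toℕ i)) , Antipodal.cycleSum≡4 b c (toℕ i)
    where
    b = proj₁ (kind j)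
    c = proj₂ (kind j)

  facePoint-onFace : ∀ k → OnFace (facePoint k)
  facePoint-onFace k = family-onFace (proj₁ basis k)

  facePoint-independent : ∀ (c : Fin D → ℚ) → (∀ e → ∑ D (λ i → c i * facePoint i e) ≡ 0ℚ) → ∀ i → c i ≡ 0ℚ
  facePoint-independent c eqs = proj₂ basis c (λ e → eqs (splitAt n e))

  unvec : ∀ {K} (p : Fin K → Point m) (c : Fin K → ℚ) → (∀ e → ∑ K (λ i → c i * toVec (p i) e) ≡ 0ℚ) →
          ∀ e → ∑ K (λ i → c i * p i e) ≡ 0ℚ
  unvec {K} p c eqs e = subst (λ e → ∑ K (λ i → c i * p i e) ≡ 0ℚ) (splitAt-join n m e) (eqs (join n m e))

  combination-cycleSum : ∀ K (c : Fin K → ℚ) (p : Fin K → Point m) → (∀ e → ∑ K (λ i → c i * p i e) ≡ 0ℚ) →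
    ∑ K (λ i → c i * cycleSum m (p i)) ≡ 0ℚ
  combination-cycleSum K c p eqs = trans (sym (cycleSum-∑ K c p)) (∑-zero n λ u → eqs (inj₁ u))

  ∑-onFace : ∀ K (c : Fin K → ℚ) (p : Fin K → Point m) → (∀ i → OnFace (p i)) → ∑ K (λ i → c i * cycleSum m (p i)) ≡ four * ∑ K c
  ∑-onFace K c p on = trans (∑-cong K λ i → trans (cong (c i *_) (proj₂ (on i))) (*-comm (c i) four)) (∑-* K four c)

  ¼ : ℚ
  ¼ = ½ * ½

  -- The hyperplane of the face misses the origin: applying `cycleSum` to a linear relation gives
  -- four times the coefficient sum, which is therefore 0. So affinely independent points of the
  -- face are linearly independent, and there are at most D of them.
  face-upper : ¬ HasAffIndep m OnFace (suc D)
  face-upper (p , on , aff) = ¬independent D (toVec ∘ p) λ c eqs → let eqs′ = unvec p c eqs in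
    aff c (trans (solve 1 (λ x → x := con ¼ :* (con four :* x)) refl (∑ (suc D) c))
      (cong (¼ *_) (trans (sym (∑-onFace (suc D) c p on)) (combination-cycleSum (suc D) c p eqs′)))) eqs′

  bond-upper : ¬ HasAffIndep m (InBond m) (suc (suc D))
  bond-upper (p , _ , aff) = ¬independent (suc D) q λ c eqs →
    aff c (trans (∑-cong (suc (suc D)) λ i → sym (*-identityʳ (c i))) (eqs zero)) (unvec p c (eqs ∘ suc))
    where
    -- Homogenization: a leading coordinate 1 turns affine independence into linear independence in
    -- one more dimension.
    q : Fin (suc (suc D)) → Fin (suc D) → ℚ
    q i zero    = 1ℚ
    q i (suc e) = toVec (p i) e

  bond-lower : HasAffIndep m (InBond m) (suc D)
  bond-lower = p , (λ { zero → cut∈Bond singleton Singleton.bond ; (suc i) → proj₁ (facePoint-onFace i) }) , aff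
    where
    p : Fin (suc D) → Point m
    p zero    = cutVec m singleton
    p (suc i) = facePoint i
    aff : AffIndep m (suc D) p
    aff c ∑c≡0 eqs = λ { zero → c₀≡0 ; (suc i) → rest i }
      where
      open ≡-Reasoning
      Σc = ∑ D (c ∘ suc)
      total : c zero * (1ℚ + 1ℚ) + four * Σc ≡ 0ℚ
      total = trans (sym (cong₂ _+_ (cong (c zero *_) Singleton.cycleSum≡2) (∑-onFace D (c ∘ suc) facePoint facePoint-onFace)))
                    (combination-cycleSum (suc D) c p eqs)
      c₀≡0 : c zero ≡ 0ℚ
      c₀≡0 = begin
        c zero
          -- The coefficients satisfy c₀ + Σc = 0 and, by `cycleSum`, 2 c₀ + 4 Σc = 0; twice the
          -- first minus half the second isolates c₀.
          ≡⟨ solve 2 (λ x y → x := (x :+ y) :+ (x :+ y) :- con ½ :* (x :* (con 1ℚ :+ con 1ℚ) :+ con four :* y)) refl (c zero) Σc ⟩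
        (c zero + Σc) + (c zero + Σc) - ½ * (c zero * (1ℚ + 1ℚ) + four * Σc)
          ≡⟨ cong₂ (λ x y → x + x - ½ * y) ∑c≡0 total ⟩
        0ℚ ∎
      rest : ∀ i → c (suc i) ≡ 0ℚ
      rest = facePoint-independent (c ∘ suc) λ e → begin
        ∑ D (λ i → c (suc i) * facePoint i e)
          ≡⟨ solve 2 (λ x y → y := con 0ℚ :* x :+ y) refl (cutVec m singleton e) (∑ D (λ i → c (suc i) * facePoint i e)) ⟩
        0ℚ * cutVec m singleton e + ∑ D (λ i → c (suc i) * facePoint i e)
          ≡⟨ cong (λ x → x * cutVec m singleton e + ∑ D (λ i → c (suc i) * facePoint i e)) (sym c₀≡0) ⟩
        c zero * cutVec m singleton e + ∑ D (λ i → c (suc i) * facePoint i e)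
          ≡⟨ eqs e ⟩
        0ℚ ∎

  facet : IsFacetCycle m (InBond m)
  -- The witness is D - 1, the dimension of the face, written so that its successor reduces to `D`.
  facet = valid , suc (suc k) ℕ.+ m ℕ.+ m ,
    ((facePoint , facePoint-onFace , λ c _ → facePoint-independent c) , face-upper) ,
    (bond-lower , bond-upper)

theorem7p2 : (m : ℕ) → 3 ℕ.≤ m → IsFacetCycle m (InBond m)
theorem7p2 (suc (suc (suc k))) _ = Face.facet k
theorem7p2 (suc zero) (s≤s ())
theorem7p2 (suc (suc zero)) (s≤s (s≤s ()))
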